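{- Let $k\ge 1$ be a fixed constant. The (multi-cycle) Replenishment Storage Problem restricted to instances with joint cycle length $k$ admits a fully polynomial time approximation scheme. Specifically, for every $\epsilon'>0$ there is a $(1+\epsilon')$-approximation algorithm, i.e. an algorithm which, given any instance with $n$ items and joint cycle length $k$, outputs a valid assignment $\mathbf{x}$ with $V(\mathbf{x})\le (1+\epsilon')V^*$, and whose running time is $O\!\left(\frac{n^{k+1}}{(\epsilon')^{k}}\right)$, which is polynomial in $n$ and $1/\epsilon'$ for constant $k$.
   Context: Replenishment Storage Problem (RSP). An instance consists of $n\ge 1$ items; item $i$ has a positive integer cycle length $k_i$ and a positive integer reorder size $s_i$. The joint cycle length is $k=\mathrm{lcm}(k_1,\ldots,k_n)$. (The multi-cycle problem allows the $k_i$ to be different.) A valid assignment is an $n\times k$ binary matrix $\mathbf{x}=(x_{ij})$ ($x_{ij}=1$ iff item $i$ is ordered at time $j$) with $\sum_{j=1}^{k_i}x_{ij}=1$ for $i=1,\ldots,n$ and $x_{ij}=x_{i,j-k_i}$ for $i=1,\ldots,n$, $j=k_i+1,\ldots,k$. Inventory levels: schedules are extended periodically with period $k$. At each time item $i$ is ordered its inventory level is $s_i$, and it then decreases by $s_i/k_i$ per time unit, so at the times $0,1,\ldots,k_i-1$ after an order its level is $s_i,\frac{k_i-1}{k_i}s_i,\ldots,\frac{1}{k_i}s_i$. That is, if $x_{ij}=1$, the level of item $i$ at time $\ell$ is $\frac{k_i-r}{k_i}s_i$, where $r\in\{0,\ldots,k_i-1\}$ and $r\equiv \ell-j \pmod{k_i}$.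 $V_\ell(\mathbf{x})$ is the sum over all items of the inventory levels at time $\ell\in\{1,\ldots,k\}$. $V(\mathbf{x})=\max_{\ell\in\{1,\ldots,k\}}V_\ell(\mathbf{x})$ is the peak storage and $V^*=\min_{\mathbf{x}\text{ valid}}V(\mathbf{x})$. The problem is to find a valid assignment minimizing $V(\mathbf{x})$. Running time counts elementary arithmetic operations (additions, comparisons, multiplications, divisions/floors on numbers, each at unit cost). The $O(\cdot)$ is asymptotic in $n$ and $1/\epsilon'$ (in particular $\epsilon'$ bounded above, e.g. $\epsilon'\le 1$), with a hidden constant depending only on the constant $k$. A fully polynomial time approximation scheme is a family of $(1+\epsilon')$-approximation algorithms, one for every $\epsilon'>0$, with running time polynomial in both the problem size and $1/\epsilon'$. -}

module Defs where

open import Data.Bool.Base using (if_then_else_)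
open import Data.Fin.Base as Fin using (Fin; zero; suc; toℕ; fromℕ<; inject≤)
open import Data.Fin.Properties as Fin using (all?; toℕ-inject≤)
open import Data.Integer.Base using (+_)
open import Data.List.Base as List using (List; filter; cartesianProductWith; allFin)
open import Data.List.Membership.Propositional using (_∈_)
open import Data.List.Membership.Propositional.Properties
  using (∈-allFin; ∈-cartesianProductWith⁺; ∈-filter⁺)
import Data.List.Extrema as Extrema
open import Data.List.Relation.Unary.All as All using (All)
open import Data.List.Relation.Unary.All.Properties using (all-filter)
open import Data.List.Relation.Unary.Any using (here)
open import Data.Nat.Base as ℕ using (ℕ; NonZero; _∸_; _%_)
open import Data.Nat.Divisibility using (_∣_; ∣-trans; ∣⇒≤)
open import Data.Nat.DivMod using ([m+n]%n≡m%n; m<n⇒m%n≡m)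
open import Data.Nat.LCM using (lcm; m∣lcm[m,n]; n∣lcm[m,n])
import Data.Nat.Properties as ℕ
open import Data.Product.Base using (∃-syntax; _×_; _,_; proj₁; proj₂)
open import Data.Rational.Base as ℚ using (ℚ; Positive; 0ℚ; 1ℚ; _/_; 1/_)
import Data.Rational.Properties as ℚ
open import Data.Vec.Base as Vec using (Vec; []; _∷_; lookup)
open import Data.Vec.Properties using (lookup∘tabulate)
open import Data.Vec.Functional as Vector using (Vector)
open import Relation.Binary.PropositionalEquality
  using (_≡_; refl; sym; trans; cong; subst)
open import Relation.Binary.Bundles using (DecTotalOrder)
open import Relation.Nullary using (¬_; Dec; yes; no; does; contradiction)
open import Relation.Nullary.Decidable using (_→-dec_; _×-dec_)

open import Algebra.Properties.Monoid.Sum ℕ.+-0-monoid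
  renaming (sum to sumℕ) using (sum-cong-≗; sum-replicate-zero)
open import Algebra.Properties.Monoid.Sum ℚ.+-0-monoid
  renaming (sum to sumℚ) using ()
open import Algebra.Definitions.RawSemiring ℚ.+-*-rawSemiring using (_^_) public
open Extrema (DecTotalOrder.totalOrder ℚ.≤-decTotalOrder) using (max; argmin; argmin-all; f[argmin]≤f[xs])

fromℕ : ℕ → ℚ
fromℕ m = + m / 1

------------------------------------------------------------------------
-- The Replenishment Storage Problem

record Instance (k n : ℕ) : Set where
  field
    cycle   : Vector ℕ n
    reorder : Vector ℕ n
    ⦃ cycle-nonZero ⦄   : ∀ {i} → NonZero (cycle i)
    ⦃ reorder-nonZero ⦄ : ∀ {i} → NonZero (reorder i)
    joint   : Vector.foldr lcm 1 cycle ≡ k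

-- Times 1, …, k are represented by 0, …, k - 1.
Matrix : ℕ → ℕ → Set
Matrix k n = Vec (Vec (Fin 2) k) n

entry : ∀ {k n} → Matrix k n → Fin n → Fin k → ℕ
entry x i j = toℕ (lookup (lookup x i) j)

∣-foldr-lcm : ∀ {n} (f : Vector ℕ n) i → f i ∣ Vector.foldr lcm 1 f
∣-foldr-lcm f zero    = m∣lcm[m,n] (f zero) _
∣-foldr-lcm f (suc i) =
  ∣-trans (∣-foldr-lcm (λ j → f (suc j)) i) (n∣lcm[m,n] (f zero) _)

module _ {k n : ℕ} .⦃ _ : NonZero k ⦄ (I : Instance k n) where
  open Instance I

  cycle≤k : ∀ i → cycle i ℕ.≤ k
  cycle≤k i = ∣⇒≤ (subst (cycle i ∣_) joint (∣-foldr-lcm cycle i))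

  -- Entry of item i at a time in its first cycle.
  firstCycle : Matrix k n → (i : Fin n) → Fin (cycle i) → ℕ
  firstCycle x i j = entry x i (inject≤ j (cycle≤k i))

  OrderedOnce : Matrix k n → Set
  OrderedOnce x = ∀ i → sumℕ (firstCycle x i) ≡ 1

  Periodic : Matrix k n → Set
  Periodic x = ∀ i (j j′ : Fin k) → toℕ j ≡ toℕ j′ ℕ.+ cycle i →
               entry x i j ≡ entry x i j′

  Valid : Matrix k n → Set
  Valid x = OrderedOnce x × Periodic x

  -- Inventory level at time ℓ of item i if it is ordered at time j of its
  -- first cycle; since j < cycle i, the subtraction is not truncated and
  -- the remainder is that of ℓ - j.
  itemLevel : (i : Fin n) → Fin (cycle i) → Fin k → ℚ
  itemLevel i j ℓ = (+ (cycle i ∸ r) / cycle i) ℚ.* fromℕ (reorder i)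
    where r = (toℕ ℓ ℕ.+ (cycle i ∸ toℕ j)) % cycle i

  -- The inner sum has exactly one nonzero term if x is valid.
  level : Matrix k n → Fin k → ℚ
  level x ℓ = sumℚ λ i → sumℚ λ j →
    fromℕ (firstCycle x i j) ℚ.* itemLevel i j ℓ

  -- Levels are nonnegative, so taking the maximum together with 0 is
  -- harmless.
  peak : Matrix k n → ℚ
  peak x = max 0ℚ (List.tabulate (level x))

  valid? : ∀ x → Dec (Valid x)
  valid? x =
    (all? λ i → _ ℕ.≟ _) ×-dec
    (all? λ i → all? λ j → all? λ j′ → (_ ℕ.≟ _) →-dec (_ ℕ.≟ _))

allVec : ∀ {A : Set} → List A → ∀ n → List (Vec A n)
allVec xs ℕ.zero    = [] List.∷ List.[]
allVec xs (ℕ.suc n) = cartesianProductWith _∷_ xs (allVec xs n)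

∈-allVec : ∀ {A : Set} {xs : List A} → (∀ a → a ∈ xs) →
           ∀ {n} (v : Vec A n) → v ∈ allVec xs n
∈-allVec full []      = here refl
∈-allVec full (a ∷ v) = ∈-cartesianProductWith⁺ _∷_ (full a) (∈-allVec full v)

allMatrices : ∀ k n → List (Matrix k n)
allMatrices k n = allVec (allVec (allFin 2) k) n

module _ {k n : ℕ} .⦃ _ : NonZero k ⦄ (I : Instance k n) where
  open Instance I

  private
    start : ℕ → Fin 2
    start ℕ.zero    = suc zero
    start (ℕ.suc _) = zero

  -- Every item is ordered at the first time of each of its cycles.
  allAtStart : Matrix k n
  allAtStart = Vec.tabulate λ i → Vec.tabulate λ j → start (toℕ j % cycle i)

  private
    entry-allAtStart : ∀ i j →
      entry allAtStart i j ≡ toℕ (start (toℕ j % cycle i))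
    entry-allAtStart i j = cong toℕ (trans
      (cong (λ r → lookup r j) (lookup∘tabulate _ i)) (lookup∘tabulate _ j))

    first : ∀ i j → firstCycle I allAtStart i j ≡ toℕ (start (toℕ j))
    first i j = trans (entry-allAtStart i (inject≤ j _))
      (cong (λ m → toℕ (start m))
        (trans (cong (_% cycle i) (toℕ-inject≤ j (cycle≤k I i)))
               (m<n⇒m%n≡m (Fin.toℕ<n j))))

    sum-start : ∀ m .⦃ _ : NonZero m ⦄ →
                sumℕ {m} (λ j → toℕ (start (toℕ j))) ≡ 1
    sum-start (ℕ.suc m) = cong ℕ.suc (sum-replicate-zero m)

  allAtStart-valid : Valid I allAtStart
  allAtStart-valid =
    (λ i → trans (sum-cong-≗ (first i)) (sum-start (cycle i))) ,
    (λ i j j′ eq → trans (entry-allAtStart i j) (trans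
      (cong (λ m → toℕ (start m))
        (trans (cong (_% cycle i) eq) ([m+n]%n≡m%n (toℕ j′) (cycle i))))
      (sym (entry-allAtStart i j′))))

  private
    validMatrices : List (Matrix k n)
    validMatrices = filter (valid? I) (allMatrices k n)

  -- Opaque only to keep type checking fast: optimal-valid and V*-minimal
  -- say that V* is the minimum of peak over the valid matrices.
  opaque
    optimal : Matrix k n
    optimal = argmin (peak I) allAtStart validMatrices

  V* : ℚ
  V* = peak I optimal

  opaque
    unfolding optimal

    optimal-valid : Valid I optimal
    optimal-valid = argmin-all (peak I) {P = Valid I} allAtStart-valid
      (all-filter (valid? I) (allMatrices k n))

    V*-minimal : ∀ x → Valid I x → V* ℚ.≤ peak I x
    V*-minimal x v = All.lookup (f[argmin]≤f[xs] allAtStart validMatrices)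
      (∈-filter⁺ (valid? I) (∈-allVec (∈-allVec ∈-allFin) x) v)

------------------------------------------------------------------------
-- Unit-cost random access machine over ℕ, as a while language whose memory
-- consists of registers and infinite arrays, both named by numbers.

record State : Set where
  constructor mkState
  field
    reg : ℕ → ℕ
    arr : ℕ → ℕ → ℕ
open State public

data Op : Set where
  add sub mul div : Op

-- Subtraction is truncated, div is ⌊ m / n ⌋, and division by zero gives 0.
⟦_⟧ : Op → ℕ → ℕ → ℕ
⟦ add ⟧ m n           = m ℕ.+ n
⟦ sub ⟧ m n           = m ∸ n
⟦ mul ⟧ m n           = m ℕ.* n
⟦ div ⟧ m ℕ.zero      = 0
⟦ div ⟧ m n@(ℕ.suc _) = m ℕ./ n

data Expr : Set where
  lit  : ℕ → Expr
  var  : ℕ → Expr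
  read : ℕ → Expr → Expr
  op   : Op → Expr → Expr → Expr

eval : State → Expr → ℕ
eval σ (lit m)    = m
eval σ (var v)    = reg σ v
eval σ (read a e) = arr σ a (eval σ e)
eval σ (op o e f) = ⟦ o ⟧ (eval σ e) (eval σ f)

cost : Expr → ℕ
cost (lit m)    = 1
cost (var v)    = 1
cost (read a e) = 1 ℕ.+ cost e
cost (op o e f) = 1 ℕ.+ cost e ℕ.+ cost f

infixr 4 _⨾_
infix  5 _≔_ _[_]≔_

data Cmd : Set where
  skip     : Cmd
  _≔_      : ℕ → Expr → Cmd
  _[_]≔_   : ℕ → Expr → Expr → Cmd
  _⨾_      : Cmd → Cmd → Cmd
  if<      : Expr → Expr → Cmd → Cmd → Cmd
  while<   : Expr → Expr → Cmd → Cmd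

_[_↦_] : ∀ {A : Set} → (ℕ → A) → ℕ → A → ℕ → A
(f [ a ↦ b ]) c = if does (c ℕ.≟ a) then b else f c

setReg : ℕ → ℕ → State → State
setReg v m σ = record σ { reg = reg σ [ v ↦ m ] }

setArr : ℕ → ℕ → ℕ → State → State
setArr a p m σ = record σ { arr = arr σ [ a ↦ arr σ a [ p ↦ m ] ] }

-- Run P σ τ t : from state σ, program P halts in state τ after t steps.
data Run : Cmd → State → State → ℕ → Set where
  skip   : ∀ {σ} → Run skip σ σ 1
  assign : ∀ {σ v e} → Run (v ≔ e) σ (setReg v (eval σ e) σ) (1 ℕ.+ cost e)
  write  : ∀ {σ a e f} →
           Run (a [ e ]≔ f) σ (setArr a (eval σ e) (eval σ f) σ)
               (1 ℕ.+ cost e ℕ.+ cost f)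
  seq    : ∀ {P Q σ τ υ s t} → Run P σ τ s → Run Q τ υ t →
           Run (P ⨾ Q) σ υ (s ℕ.+ t)
  then   : ∀ {e f P Q σ τ t} → eval σ e ℕ.< eval σ f → Run P σ τ t →
           Run (if< e f P Q) σ τ (1 ℕ.+ cost e ℕ.+ cost f ℕ.+ t)
  else   : ∀ {e f P Q σ τ t} → ¬ eval σ e ℕ.< eval σ f → Run Q σ τ t →
           Run (if< e f P Q) σ τ (1 ℕ.+ cost e ℕ.+ cost f ℕ.+ t)
  loop   : ∀ {e f P σ τ υ s t} → eval σ e ℕ.< eval σ f →
           Run P σ τ s → Run (while< e f P) τ υ t →
           Run (while< e f P) σ υ (1 ℕ.+ cost e ℕ.+ cost f ℕ.+ s ℕ.+ t)
  done   : ∀ {e f P σ} → ¬ eval σ e ℕ.< eval σ f →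
           Run (while< e f P) σ σ (1 ℕ.+ cost e ℕ.+ cost f)

Run-deterministic : ∀ {P σ τ τ′ t t′} → Run P σ τ t → Run P σ τ′ t′ →
                    τ ≡ τ′ × t ≡ t′
Run-deterministic skip        skip          = refl , refl
Run-deterministic assign      assign        = refl , refl
Run-deterministic write       write         = refl , refl
Run-deterministic (seq p q)   (seq p′ q′)
  with refl , refl ← Run-deterministic p p′
  with refl , refl ← Run-deterministic q q′ = refl , refl
Run-deterministic (then _ p)  (then _ p′)
  with refl , refl ← Run-deterministic p p′ = refl , refl
Run-deterministic (then c _)  (else ¬c _)   = contradiction c ¬c
Run-deterministic (else ¬c _) (then c _)    = contradiction c ¬c
Run-deterministic (else _ p)  (else _ p′)
  with refl , refl ← Run-deterministic p p′ = refl , refl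
Run-deterministic (loop _ p q) (loop _ p′ q′)
  with refl , refl ← Run-deterministic p p′
  with refl , refl ← Run-deterministic q q′ = refl , refl
Run-deterministic (loop c _ _) (done ¬c)    = contradiction c ¬c
Run-deterministic (done ¬c) (loop c _ _)    = contradiction c ¬c
Run-deterministic (done _)  (done _)        = refl , refl

------------------------------------------------------------------------
-- Algorithms for the problem

padded : ∀ {n} → Vector ℕ n → ℕ → ℕ
padded {n} f p with p ℕ.<? n
... | yes p<n = f (fromℕ< p<n)
... | no  _   = 0

-- Register 0 holds n, arrays 0 and 1 hold the cycle lengths and the reorder
-- sizes; everything else is 0.
input : ∀ {k n} → Instance k n → State
input {n = n} I = mkState
  (λ { 0 → n ; _ → 0 })
  (λ { 0 → padded (Instance.cycle I)
     ; 1 → padded (Instance.reorder I)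
     ; _ → λ _ → 0 })

-- The matrix is output row by row in array 2.
Outputs : ∀ {k n} → State → Matrix k n → Set
Outputs {k} σ x = ∀ i j → arr σ 2 (toℕ i ℕ.* k ℕ.+ toℕ j) ≡ entry x i j

module _ (k : ℕ) .⦃ _ : NonZero k ⦄ where

  IsApproximation : ℚ → Cmd → Set
  IsApproximation ε P = ∀ n .⦃ _ : NonZero n ⦄ (I : Instance k n) →
    ∃[ τ ] ∃[ t ] Run P (input I) τ t ×
      ∃[ x ] Outputs τ x × Valid I x × peak I x ℚ.≤ (1ℚ ℚ.+ ε) ℚ.* V* I

  RunsWithin : (ℕ → ℚ) → Cmd → Set
  RunsWithin T P = ∀ n .⦃ _ : NonZero n ⦄ (I : Instance k n) →
    ∀ {τ t} → Run P (input I) τ t → fromℕ t ℚ.≤ T n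

  recip : (ε : ℚ) .⦃ _ : Positive ε ⦄ → ℚ
  recip ε = (1/ ε) ⦃ ℚ.pos⇒nonZero ε ⦄

  -- As n + 1/ε > 1, a bound polynomial in n and 1/ε is the same as one by
  -- c (n + 1/ε)^d. At unit cost per operation, n is the problem size.
  record FPTAS : Set where
    field
      algorithm     : ℚ → Cmd
      approximation : ∀ ε .⦃ _ : Positive ε ⦄ →
                      IsApproximation ε (algorithm ε)
      polynomial    : ∃[ c ] ∃[ d ] ∀ ε .⦃ _ : Positive ε ⦄ →
                      RunsWithin (λ n → fromℕ c ℚ.* (fromℕ n ℚ.+ recip ε) ^ d)
                                 (algorithm ε)

{-# OPTIONS --safe #-}

-- Let S be the sum of all reorder sizes. Levels never fall below s_i / k_i, so
-- S ≤ k V*. With m > 1 / ε and D = k m n, round the contribution of every item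
-- to every level down to a multiple of S / D. This changes a level by at most
-- n S / D = S / (k m) ≤ ε V*, so it suffices to minimise the rounded peak. The
-- rounded levels at the k times lie in {0, …, D}; reading them as the digits
-- of a number in base D + 1 turns the choice of order times into a shortest
-- path problem on n + 1 layers of (D + 1)^k nodes with k edges each, which a
-- table of (n + 1) (D + 1)^k = O(n^(k+1) / ε^k) cells solves. As k is constant,
-- everything done per cell is a single expression unrolled over the k times.

module Submission where

open import Defs renaming (_^_ to _^ℚ_)
open import Algebra.Bundles using (CommutativeRing)
import Algebra.Properties.CommutativeSemiring.Exp as CommutativeExp
import Algebra.Properties.Monoid.Sum as Sum
import Algebra.Properties.Semiring.Exp as Exp
open import Data.Bool.Base using (if_then_else_)
open import Data.Fin.Base using (Fin; zero; suc; toℕ; fromℕ<)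
import Data.Fin.Properties as Fin
import Data.Integer.Base as ℤ
import Data.Integer.Properties as ℤ
open import Data.List.Base as List using (List; []; _∷_)
import Data.List.Extrema as Extrema
open import Data.List.Relation.Unary.All.Properties using (tabulate⁺; tabulate⁻)
open import Data.Nat.Base
open import Data.Nat.Divisibility using (divides)
open import Data.Nat.DivMod
open import Data.Nat.ListAction using (sum)
open import Data.Nat.Properties
open import Data.Nat.Solver using (module +-*-Solver)
open import Data.Product.Base using (Σ-syntax; ∃-syntax; _×_; _,_; proj₁; proj₂)
open import Data.Rational.Base as ℚ using (ℚ; 0ℚ; 1ℚ; Positive)
import Data.Rational.Properties as ℚ
import Data.Rational.Solver
import Data.Rational.Unnormalised.Base as ℚᵘ
import Data.Rational.Unnormalised.Properties as ℚᵘ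
open import Data.Sum.Base using (inj₁; inj₂)
open import Data.Vec.Base as Vec using (lookup)
open import Data.Vec.Properties using (lookup∘tabulate)
open import Function.Base using (_∘_)
open import Relation.Binary.Bundles using (DecTotalOrder)
open import Relation.Binary.Definitions using (tri<; tri≈; tri>)
open import Relation.Binary.PropositionalEquality
open import Relation.Nullary using (¬_; yes; no; contradiction)
open import Relation.Nullary.Decidable using (dec-true; dec-false)

open Extrema (DecTotalOrder.totalOrder ℚ.≤-decTotalOrder) using (max≤v⁺; ⊥≤max; xs≤max)
open Sum +-0-monoid using () renaming (sum to sumℕ)
open Sum ℚ.+-0-monoid using () renaming (sum to sumℚ)

private
  module ℚ-Solver = Data.Rational.Solver.+-*-Solver
  module ℚ-Ring = CommutativeRing ℚ.+-*-commutativeRing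
  module ℚ-Exp = Exp ℚ-Ring.semiring
  module ℚ-CommutativeExp = CommutativeExp ℚ-Ring.commutativeSemiring

-- Adding weights adds the levels digit by digit only while no digit exceeds D. Rounding down
-- guarantees this: a digit of item i is at most `siz i * D / S`, so the digits of all n items at
-- one time add up to at most D. This covers the codes reachable from 0 in the top layer, but not an
-- arbitrary cell, where the address of a successor may even run into a part of the table that is
-- still empty. Hence the table is claimed to be correct only for codes satisfying `Fits`; the
-- remaining cells hold junk on which the answer does not depend.
--
-- Each cell packs a least peak together with an order time attaining it, so an assignment can be
-- traced back from the answer without minimising again.
--
-- The value ε enters the text of the program only through the literal `k * m`, whose cost is 1. All
-- constants in the time bound are therefore computed from the syntax and depend on k alone.

private variable
  P P′    : Cmd
  σ       : State
  Q R     : State → Set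
  T T′    : ℕ

-- Total correctness with a bound on the number of steps

Halts : Cmd → State → (State → Set) → ℕ → Set
Halts P σ Q T = ∃[ τ ] ∃[ t ] Run P σ τ t × t ≤ T × Q τ

weaken : T ≤ T′ → Halts P σ Q T → Halts P σ Q T′
weaken T≤T′ (τ , t , run , t≤T , q) = τ , t , run , ≤-trans t≤T T≤T′ , q

-- The machine is deterministic, so a bound for the one run exhibited applies to every run, as
-- `RunsWithin` demands.
halts⇒≤ : ∀ {τ t} → Halts P σ Q T → Run P σ τ t → t ≤ T
halts⇒≤ (_ , _ , run , t≤T , _) run′ with refl , refl ← Run-deterministic run run′ = t≤T

map-halts : (∀ {τ} → Q τ → R τ) → Halts P σ Q T → Halts P σ R T
map-halts f (τ , t , run , t≤T , q) = τ , t , run , t≤T , f q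

-- Junk on loops, to which it is not applied
bound : Cmd → ℕ
bound skip         = 1
bound (v ≔ e)      = 1 + cost e
bound (a [ e ]≔ f) = 1 + cost e + cost f
bound (P ⨾ P′)     = bound P + bound P′
-- Adding the two branches bounds either of them, so the bound depends on the command alone.
bound (if< e f P P′) = 1 + cost e + cost f + (bound P + bound P′)
bound (while< e f P) = 0

Ends : Cmd → State → (State → Set) → Set
Ends P σ Q = Halts P σ Q (bound P)

assign-ends : ∀ v e → Q (setReg v (eval σ e) σ) → Ends (v ≔ e) σ Q
assign-ends v e q = _ , _ , assign , ≤-refl , q

write-ends : ∀ a e f → Q (setArr a (eval σ e) (eval σ f) σ) → Ends (a [ e ]≔ f) σ Q
write-ends a e f q = _ , _ , write , ≤-refl , q

seq-halts : Halts P σ Q T → (∀ {τ} → Q τ → Halts P′ τ R T′) →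
            Halts (P ⨾ P′) σ R (T + T′)
seq-halts (τ , s , run , s≤ , q) h with h q
... | υ , t , run′ , t≤ , r = υ , s + t , seq run run′ , +-mono-≤ s≤ t≤ , r

seq-ends : Ends P σ Q → (∀ {τ} → Q τ → Ends P′ τ R) → Ends (P ⨾ P′) σ R
seq-ends = seq-halts

then-ends : ∀ e f → eval σ e < eval σ f → Ends P σ Q → Ends (if< e f P P′) σ Q
then-ends e f c (τ , t , run , t≤ , q) =
  τ , _ , then c run , +-monoʳ-≤ (1 + cost e + cost f) (m≤n⇒m≤n+o _ t≤) , q

else-ends : ∀ e f → ¬ eval σ e < eval σ f → Ends P′ σ Q → Ends (if< e f P P′) σ Q
else-ends e f c (τ , t , run , t≤ , q) =
  τ , _ , else c run , +-monoʳ-≤ (1 + cost e + cost f) (m≤n⇒m≤o+n _ t≤) , q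

-- The invariant is indexed by the number of remaining iterations.
while-halts : ∀ {e f} (Inv : ℕ → State → Set) →
  (∀ {i σ} → Inv (suc i) σ → eval σ e < eval σ f × Halts P σ (Inv i) T) →
  (∀ {σ} → Inv 0 σ → ¬ eval σ e < eval σ f) →
  ∀ i {σ} → Inv i σ →
  Halts (while< e f P) σ (Inv 0)
        (i * (1 + cost e + cost f + T) + (1 + cost e + cost f))
while-halts Inv body exit zero inv = _ , _ , done (exit inv) , ≤-refl , inv
while-halts {T = T} {e} {f} Inv body exit (suc i) inv
  with c , τ , s , run , s≤ , inv′ ← body inv
  with υ , t , run′ , t≤ , inv″ ← while-halts {e = e} {f} Inv body exit i inv′
  = υ , _ , loop c run run′ ,
    ≤-trans (+-mono-≤ (+-monoʳ-≤ g s≤) t≤)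
            (≤-reflexive (sym (+-assoc (g + T) (i * (g + T)) g))) ,
    inv″
  where g = 1 + cost e + cost f

update-≡ : ∀ (f : ℕ → ℕ) a {b c} → c ≡ a → (f [ a ↦ b ]) c ≡ b
update-≡ f a {b} {c} eq = cong (λ d → if d then b else f c) (dec-true (c ≟ a) eq)

update-≢ : ∀ (f : ℕ → ℕ) a {b c} → c ≢ a → (f [ a ↦ b ]) c ≡ f c
update-≢ f a {b} {c} ne = cong (λ d → if d then b else f c) (dec-false (c ≟ a) ne)

-- Division and remainder

rem : ℕ → ℕ → ℕ
rem m n = m ∸ ⟦ div ⟧ m n * n

div≡/ : ∀ m n .⦃ _ : NonZero n ⦄ → ⟦ div ⟧ m n ≡ m / n
div≡/ m (suc n) = refl

rem≡% : ∀ m n .⦃ _ : NonZero n ⦄ → rem m n ≡ m % n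
rem≡% m n@(suc _) = sym (m%n≡m∸m/n*n m n)

div-*+ : ∀ q n r → r < n → ⟦ div ⟧ (q * n + r) n ≡ q
div-*+ q n@(suc _) r r<n = begin
  (q * n + r) / n    ≡⟨ +-distrib-/-∣ˡ r (divides q refl) ⟩
  q * n / n + r / n  ≡⟨ cong₂ _+_ (m*n/n≡m q n) (m<n⇒m/n≡0 r<n) ⟩
  q + 0              ≡⟨ +-identityʳ q ⟩
  q                  ∎
  where open ≡-Reasoning

rem-*+ : ∀ q n r → r < n → rem (q * n + r) n ≡ r
rem-*+ q n r r<n = trans (cong (λ d → q * n + r ∸ d * n) (div-*+ q n r r<n))
                         (m+n∸m≡n (q * n) r)

m∸[m∸n]≡m⊓n : ∀ m n → m ∸ (m ∸ n) ≡ m ⊓ n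
m∸[m∸n]≡m⊓n m n with ≤-total m n
... | inj₁ m≤n = trans (cong (m ∸_) (m≤n⇒m∸n≡0 m≤n)) (sym (m≤n⇒m⊓n≡m m≤n))
... | inj₂ n≤m = trans (m∸[m∸n]≡n n≤m) (sym (m≥n⇒m⊓n≡n n≤m))

m+[n∸m]≡m⊔n : ∀ m n → m + (n ∸ m) ≡ m ⊔ n
m+[n∸m]≡m⊔n m n with ≤-total m n
... | inj₁ m≤n = trans (m+[n∸m]≡n m≤n) (sym (m≤n⇒m⊔n≡n m≤n))
... | inj₂ n≤m = trans (cong (m +_) (m≤n⇒m∸n≡0 n≤m))
                       (trans (+-identityʳ m) (sym (m≥n⇒m⊔n≡m n≤m)))

-- The machine has no minimum: x ⊓ y is computed as x ∸ (x ∸ y).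
-- The case l = 0 is junk.
minimum : (ℕ → ℕ) → ℕ → ℕ
minimum f zero    = f 0
minimum f (suc l) = f l ∸ (f l ∸ minimum f l)

minimum-attained : ∀ f l → 0 < l → ∃[ j ] j < l × minimum f l ≡ f j
minimum-attained f (suc zero)    _ =
  0 , s≤s z≤n , trans (m∸[m∸n]≡m⊓n (f 0) (f 0)) (⊓-idem (f 0))
minimum-attained f (suc (suc l)) _
  with ⊓-sel (f (suc l)) (minimum f (suc l)) | minimum-attained f (suc l) (s≤s z≤n)
... | inj₁ eq | _           =
  suc l , ≤-refl , trans (m∸[m∸n]≡m⊓n (f (suc l)) _) eq
... | inj₂ eq | j , j< , at =
  j , m<n⇒m<1+n j< , trans (m∸[m∸n]≡m⊓n (f (suc l)) _) (trans eq at)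

minimum-≤ : ∀ f l {j} → j < l → minimum f l ≤ f j
minimum-≤ f (suc l) j<1+l with m≤n⇒m<n∨m≡n (≤-pred j<1+l)
... | inj₁ j<l  = ≤-trans (≤-reflexive (m∸[m∸n]≡m⊓n (f l) _)) (≤-trans (m⊓n≤n (f l) _) (minimum-≤ f l j<l))
... | inj₂ refl = m∸n≤m (f l) (f l ∸ minimum f l)

minimum-cong : ∀ {f g} l → 0 < l → (∀ {j} → j < l → f j ≡ g j) →
               minimum f l ≡ minimum g l
minimum-cong {f} {g} l 0<l f≗g = go l ≤-refl
  where
  go : ∀ l′ → l′ ≤ l → minimum f l′ ≡ minimum g l′
  go zero     _    = f≗g 0<l
  go (suc l′) l′<l = cong₂ (λ a b → a ∸ (a ∸ b)) (f≗g l′<l) (go l′ (<⇒≤ l′<l))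

-- Codes of level vectors and the recurrence for the least peak.

distance : ℕ → ℕ → ℕ
distance a b = (a ∸ b) + (b ∸ a)

sumTo : (ℕ → ℕ) → ℕ → ℕ
sumTo f zero    = 0
sumTo f (suc r) = sumTo f r + f r

code : ℕ → (ℕ → ℕ) → ℕ → ℕ
code B u zero    = 0
code B u (suc l) = u 0 + B * code B (u ∘ suc) l

-- In truncated arithmetic `d + (y ∸ d)` is the maximum of d and y.
maxDigit : ℕ → ℕ → ℕ → ℕ
maxDigit B zero    x = 0
maxDigit B (suc l) x = d + (maxDigit B l (⟦ div ⟧ x B) ∸ d)
  where d = rem x B

-- The data that stay fixed once registers 1 to 3 are set. Registers 4 and 5 and arrays 2 to 4 are
-- left out, so that the later loops preserve `envOf` by mere computation.
record Env : Set where
  constructor mkEnv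
  field
    cyc siz : ℕ → ℕ
    n S D M : ℕ

module Model (k : ℕ) (E : Env) where
  open Env E

  B : ℕ
  B = suc D

  -- The order time j ranges over all numbers below k and counts modulo `cyc i`. Thus all items have
  -- the same k candidates despite their different cycles; for a short cycle several candidates mean
  -- the same schedule.
  age : ℕ → ℕ → ℕ → ℕ
  age i j ℓ = rem (ℓ + (cyc i ∸ rem j (cyc i))) (cyc i)

  -- Level ℓ times D / S, rounded down, of item i if it is ordered at time j
  digit : ℕ → ℕ → ℕ → ℕ
  digit i j ℓ = ⟦ div ⟧ ((cyc i ∸ age i j ℓ) * siz i * D) (cyc i * S)

  weight : ℕ → ℕ → ℕ
  weight i j = code B (digit i j) k

  -- Levels with code c are to be completed by choices for items r - 1, …, 0;
  -- pack r c is k v + j, where v is the least possible peak and j is a choice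
  -- for item r - 1 attaining it.
  pack : ℕ → ℕ → ℕ
  pack zero    c = maxDigit B k c * k
  pack (suc r) c = minimum (λ j → ⟦ div ⟧ (pack r (c + weight r j)) k * k + j) k

  final : (ℕ → ℕ) → ℕ → ℕ → ℕ
  final φ zero    c = c
  final φ (suc r) c = final φ r (c + weight r (φ r))

  -- No completion of c exceeds the range M of the codes.
  Fits : ℕ → ℕ → Set
  Fits zero    c = c < M
  Fits (suc r) c = ∀ {j} → j < k → Fits r (c + weight r j)

  -- As `distance` vanishes only for equal arguments, subtracting it from 1 with truncation gives
  -- the 0-1 indicator of equality.
  ordered : (ℕ → ℕ) → ℕ → ℕ → ℕ
  ordered φ i ℓ = 1 ∸ distance (rem ℓ (cyc i)) (rem (φ i) (cyc i))

envOf : State → Env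
envOf σ = mkEnv (arr σ 0) (arr σ 1) (reg σ 0) (reg σ 1) (reg σ 2) (reg σ 3)

-- The program.

infixl 6 _⊞_ _⊟_
infixl 7 _⊠_ _⊘_
_⊞_ _⊟_ _⊠_ _⊘_ : Expr → Expr → Expr
_⊞_ = op add
_⊟_ = op sub
_⊠_ = op mul
_⊘_ = op div

remE : Expr → Expr → Expr
remE x y = x ⊟ x ⊘ y ⊠ y

baseE : Expr
baseE = lit 1 ⊞ var 2

digitE : Expr → Expr → Expr → Expr
digitE i j ℓ = ((c ⊟ remE (ℓ ⊞ (c ⊟ remE j c)) c) ⊠ read 1 i ⊠ var 2) ⊘ (c ⊠ var 1)
  where c = read 0 i

codeE : (ℕ → Expr) → ℕ → Expr
codeE f zero    = lit 0
codeE f (suc l) = f 0 ⊞ baseE ⊠ codeE (f ∘ suc) l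

powE : ℕ → Expr
powE zero    = lit 1
powE (suc l) = baseE ⊠ powE l

maxDigitE : ℕ → Expr → Expr
maxDigitE zero    x = lit 0
maxDigitE (suc l) x = remE x baseE ⊞ (maxDigitE l (x ⊘ baseE) ⊟ remE x baseE)

minimumE : (ℕ → Expr) → ℕ → Expr
minimumE f zero    = f 0
minimumE f (suc l) = f l ⊟ (f l ⊟ minimumE f l)

eval-code : ∀ σ f l → eval σ (codeE f l) ≡ code (suc (reg σ 2)) (λ ℓ → eval σ (f ℓ)) l
eval-code σ f zero    = refl
eval-code σ f (suc l) =
  cong (λ x → eval σ (f 0) + suc (reg σ 2) * x) (eval-code σ (f ∘ suc) l)

eval-pow : ∀ σ l → eval σ (powE l) ≡ suc (reg σ 2) ^ l
eval-pow σ zero    = refl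
eval-pow σ (suc l) = cong (suc (reg σ 2) *_) (eval-pow σ l)

eval-maxDigit : ∀ σ l x → eval σ (maxDigitE l x) ≡ maxDigit (suc (reg σ 2)) l (eval σ x)
eval-maxDigit σ zero    x = refl
eval-maxDigit σ (suc l) x = cong (λ y → d + (y ∸ d)) (eval-maxDigit σ l (x ⊘ baseE))
  where d = rem (eval σ x) (suc (reg σ 2))

eval-minimum : ∀ σ f l → eval σ (minimumE f l) ≡ minimum (λ j → eval σ (f j)) l
eval-minimum σ f zero    = refl
eval-minimum σ f (suc l) = cong (λ y → eval σ (f l) ∸ (eval σ (f l) ∸ y)) (eval-minimum σ f l)

loopFactor : ℕ → Cmd → ℕ
loopFactor d (while< e f P) = d * (1 + cost e + cost f + bound P) + (1 + cost e + cost f)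
loopFactor d _              = 0

-- Registers: 0 n, 1 S, 2 D, 3 M, 4 loop variable, 5 chosen order time.
-- Arrays: 0 cycles, 1 sizes, 2 output, 3 table of pack r c at r M + c,
-- 4 chosen order times.
module Program (k : ℕ) where

  weightE : Expr → Expr → Expr
  weightE i j = codeE (λ ℓ → digitE i j (lit ℓ)) k

  -- Cells of layer `suc r` decide about item r, hence the subtraction of 1.
  itemE : Expr
  itemE = var 4 ⊘ var 3 ⊟ lit 1

  candidateE : ℕ → Expr
  candidateE j = read 3 (var 4 ⊟ var 3 ⊞ weightE itemE (lit j)) ⊘ lit k ⊠ lit k ⊞ lit j

  advance : Cmd
  advance = 4 ≔ var 4 ⊞ lit 1

  addSize fillCell chooseItem writeEntry : Cmd
  addSize    = 1 ≔ var 1 ⊞ read 1 (var 4) ⨾ advance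
  fillCell   = if< (var 4) (var 3)
                 (3 [ var 4 ]≔ maxDigitE k (var 4) ⊠ lit k)
                 (3 [ var 4 ]≔ minimumE candidateE k)
               ⨾ advance
  chooseItem = 5 ≔ remE (read 3 (var 4)) (lit k)
             ⨾ 4 [ itemE ]≔ var 5
             ⨾ 4 ≔ var 4 ⊟ var 3 ⊞ weightE itemE (var 5)
  writeEntry = 2 [ var 4 ]≔ lit 1 ⊟ ((a ⊟ b) ⊞ (b ⊟ a)) ⨾ advance
    where
    i = var 4 ⊘ lit k
    a = remE (remE (var 4) (lit k)) (read 0 i)
    b = remE (read 4 i) (read 0 i)

  sumLoop fillLoop traceLoop writeLoop initialise toAnswer toStart : Cmd
  sumLoop    = while< (var 4) (var 0) addSize
  initialise = 3 ≔ powE k ⨾ 4 ≔ lit 0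
  fillLoop   = while< (var 4) ((lit 1 ⊞ var 0) ⊠ var 3) fillCell
  toAnswer   = 4 ≔ var 0 ⊠ var 3
  -- The test says `M ≤ p` for the position p; the loop ends in layer 0, where no item is left to
  -- decide.
  traceLoop  = while< (var 3) (lit 1 ⊞ var 4) chooseItem
  toStart    = 4 ≔ lit 0
  writeLoop  = while< (var 4) (var 0 ⊠ lit k) writeEntry

  setScale : ℕ → Cmd
  setScale m = 2 ≔ lit (k * m) ⊠ var 0

  program : ℕ → Cmd
  program m = sumLoop ⨾ setScale m ⨾ initialise ⨾ fillLoop ⨾ toAnswer ⨾
              traceLoop ⨾ toStart ⨾ writeLoop

  -- The argument d of `loopFactor` bounds the iterations by `d * (n * M)`: there are n for the sum,
  -- `suc n * M ≤ 2 * (n * M)` for the table, n for the trace and `n * k` for the output. As a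
  -- literal costs 1 whatever its value, `setScale 0` may stand for `setScale m`.
  factors : List ℕ
  factors = loopFactor 1 sumLoop ∷ bound (setScale 0) ∷ bound initialise ∷
    loopFactor 2 fillLoop ∷ bound toAnswer ∷ loopFactor 1 traceLoop ∷
    bound toStart ∷ loopFactor k writeLoop ∷ []

-- Time bounds as multiples of one quantity.

module Scaled (X : ℕ) (1≤X : 1 ≤ X) where

  const-≤ : ∀ {a} → a ≤ a * X
  const-≤ {a} = subst (_≤ a * X) (*-identityʳ a) (*-monoʳ-≤ a 1≤X)

  linear-≤ : ∀ {i} d a b → i ≤ d * X → i * a + b ≤ (d * a + b) * X
  linear-≤ {i} d a b i≤ = begin
    i * a + b           ≤⟨ +-mono-≤ (*-monoˡ-≤ a i≤) const-≤ ⟩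
    d * X * a + b * X   ≡⟨ cong (_+ b * X) (trans (*-assoc d X a) (trans (cong (d *_) (*-comm X a)) (sym (*-assoc d a X)))) ⟩
    d * a * X + b * X   ≡⟨ *-distribʳ-+ X (d * a) b ⟨
    (d * a + b) * X     ∎
    where open ≤-Reasoning

  -- All stages are charged to the same X, later `n * M`, so that only their constant factors add
  -- up.
  record Stages (P : Cmd) (σ : State) (Q : State → Set) (as : List ℕ) : Set where
    constructor stages
    field halts : Halts P σ Q (sum as * X)

  open Stages public

  infixr 1 _and-then_
  _and-then_ : ∀ {P P′ σ Q R a as} → Halts P σ Q (a * X) →
           (∀ {τ} → Q τ → Stages P′ τ R as) → Stages (P ⨾ P′) σ R (a ∷ as)
  _and-then_ {a = a} {as} h h′ = stages
    (weaken (≤-reflexive (sym (*-distribʳ-+ X a (sum as)))) (seq-halts h (halts ∘ h′)))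

  finally : ∀ {P σ Q a} → Halts P σ Q (a * X) → Stages P σ Q (a ∷ [])
  finally {a = a} h = stages (weaken (≤-reflexive (cong (_* X) (sym (+-identityʳ a)))) h)

  ends-scaled : ∀ {P σ Q} → Ends P σ Q → Halts P σ Q (bound P * X)
  ends-scaled = weaken const-≤

  while-scaled : ∀ {e f P} (Inv : ℕ → State → Set) →
    (∀ {i σ} → Inv (suc i) σ → eval σ e < eval σ f × Ends P σ (Inv i)) →
    (∀ {σ} → Inv 0 σ → ¬ eval σ e < eval σ f) →
    ∀ {i} d {σ} → i ≤ d * X → Inv i σ →
    Halts (while< e f P) σ (Inv 0) (loopFactor d (while< e f P) * X)
  while-scaled {e} {f} Inv body exit {i} d i≤ inv =
    weaken (linear-≤ d _ _ i≤) (while-halts {e = e} {f} Inv body exit i inv)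

-- Loop invariants of the program.

module Correctness (k : ℕ) (0<k : 0 < k) (E : Env) (0<M : 0 < Env.M E) where
  open Env E
  open Model k E
  open Program k

  -- Codes never shrink under completion, and order time 0 for every remaining item is one of the
  -- completions.
  code-fits : ∀ r c → Fits r c → c < M
  code-fits zero    c fits = fits
  code-fits (suc r) c fits = <-≤-trans (s≤s (m≤m+n c _)) (code-fits r _ (fits 0<k))

  -- Nothing is said about codes that do not fit: a successor of such a cell may have an address
  -- outside the preceding layer.
  Table : ℕ → State → Set
  Table p σ = ∀ r c → r * M + c < p → Fits r c → arr σ 3 (r * M + c) ≡ pack r c

  Filling : ℕ → State → Set
  Filling i σ = envOf σ ≡ E × reg σ 4 + i ≡ suc n * M × Table (reg σ 4) σ

  Table-write : ∀ p σ {v} → Table p σ →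
                (∀ r c → r * M + c ≡ p → Fits r c → v ≡ pack r c) →
                Table (p + 1) (setArr 3 p v σ)
  Table-write p σ table new r c <p+1 fits with (r * M + c) ≟ p
  ... | yes eq = trans (update-≡ (arr σ 3) p eq) (new r c eq fits)
  ... | no  ne = trans (update-≢ (arr σ 3) p ne) (table r c (≤∧≢⇒< (≤-pred (subst (r * M + c <_) (+-comm p 1) <p+1)) ne) fits)

  -- The address read is `p ∸ M` plus a weight. A fitting code is below M, hence so is the weight,
  -- and the address lies before p, where the table is already filled.
  eval-candidate : ∀ σ r c → envOf σ ≡ E → Table (reg σ 4) σ →
    r * M + c ≡ reg σ 4 ∸ M → ⟦ div ⟧ (reg σ 4) M ∸ 1 ≡ r → M ≤ reg σ 4 →
    ∀ {j} → Fits r (c + weight r j) →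
    eval σ (candidateE j) ≡ ⟦ div ⟧ (pack r (c + weight r j)) k * k + j
  eval-candidate σ r c refl table pos item M≤p {j} fits =
    cong (λ x → ⟦ div ⟧ x k * k + j) (trans (cong (arr σ 3) address)
      (table r _ (subst (_< reg σ 4) address lt) fits))
    where
    w : eval σ (weightE itemE (lit j)) ≡ weight r j
    w = trans (eval-code σ _ k) (cong (λ i → weight i j) item)
    address : reg σ 4 ∸ M + eval σ (weightE itemE (lit j)) ≡ r * M + (c + weight r j)
    address = trans (cong₂ _+_ (sym pos) w) (+-assoc (r * M) c (weight r j))
    lt : reg σ 4 ∸ M + eval σ (weightE itemE (lit j)) < reg σ 4
    lt = begin-strict
      reg σ 4 ∸ M + eval σ (weightE itemE (lit j)) ≡⟨ cong (reg σ 4 ∸ M +_) w ⟩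
      reg σ 4 ∸ M + weight r j     <⟨ +-monoʳ-< (reg σ 4 ∸ M) (≤-<-trans (m≤n+m _ c) (code-fits r _ fits)) ⟩
      reg σ 4 ∸ M + M              ≡⟨ m∸n+n≡m M≤p ⟩
      reg σ 4                      ∎
      where open ≤-Reasoning

  fill-body : ∀ {i σ} → Filling (suc i) σ →
    reg σ 4 < suc (reg σ 0) * reg σ 3 × Ends fillCell σ (Filling i)
  fill-body {i} {σ} (refl , count , table) =
    m+n≤o⇒m≤o (suc (reg σ 4)) (≤-reflexive count′) ,
    seq-ends {Q = Filled} cell
      (λ { (env , pos , table′) → assign-ends 4 _ (env ,
        trans (cong (_+ i) (trans (cong (_+ 1) pos) (+-comm p 1))) count′ , λ r c → table′ r c ∘ subst (λ q → r * M + c < q + 1) pos) })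
    where
    p = reg σ 4
    count′ : suc p + i ≡ suc n * M
    count′ = trans (sym (+-suc p i)) count
    Filled : State → Set
    Filled τ = envOf τ ≡ E × reg τ 4 ≡ p × Table (p + 1) τ
    first : p < M → ∀ r c → r * M + c ≡ p → Fits r c → eval σ (maxDigitE k (var 4) ⊠ lit k) ≡ pack r c
    first p<M zero    c refl fits = cong (_* k) (eval-maxDigit σ k (var 4))
    first p<M (suc r) c eq   fits = contradiction p<M (≤⇒≯ (subst (M ≤_) eq (≤-trans (m≤m+n M (r * M)) (m≤m+n _ c))))
    later : ¬ p < M → ∀ r c → r * M + c ≡ p → Fits r c → eval σ (minimumE candidateE k) ≡ pack r c
    later p≮M zero    c eq fits = contradiction (subst (_< M) eq fits) p≮M
    later p≮M (suc r) c eq fits = trans (eval-minimum σ candidateE k) (minimum-cong k 0<k λ {j} j<k →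
      eval-candidate σ r c refl table
        (trans (sym (m+n∸m≡n M (r * M + c))) (cong (_∸ M) (trans (sym (+-assoc M (r * M) c)) eq)))
        (cong (_∸ 1) (trans (cong (λ q → ⟦ div ⟧ q M) (sym eq)) (div-*+ (suc r) M c (code-fits (suc r) c fits))))
        (≮⇒≥ p≮M) {j} (fits j<k))
    cell : Ends _ σ Filled
    cell with p <? M
    ... | yes p<M = then-ends (var 4) (var 3) p<M
                      (write-ends 3 _ _ (refl , refl , Table-write p σ table (first p<M)))
    ... | no  p≮M = else-ends (var 4) (var 3) p≮M
                      (write-ends 3 _ _ (refl , refl , Table-write p σ table (later p≮M)))

  value : ℕ → ℕ → ℕ
  value r c = ⟦ div ⟧ (pack r c) k

  choice : ℕ → ℕ → ℕ
  choice r c = rem (pack r c) k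

  -- The minimum is one of the candidates `v * k + j`, and `j < k` lets quotient and remainder by k
  -- recover both parts.
  pack-attained : ∀ r c → choice (suc r) c < k ×
                  value (suc r) c ≡ value r (c + weight r (choice (suc r) c))
  pack-attained r c
    with j , j<k , eq ← minimum-attained (λ j → value r (c + weight r j) * k + j) k 0<k
    = subst (_< k) (sym choice≡j) j<k ,
      trans (trans (cong (λ x → ⟦ div ⟧ x k) eq) (div-*+ _ k j j<k))
            (cong (λ j → value r (c + weight r j)) (sym choice≡j))
    where
    choice≡j : choice (suc r) c ≡ j
    choice≡j = trans (cong (λ x → rem x k) eq) (rem-*+ (value r (c + weight r j)) k j j<k)

  div-mono : ∀ {x y} → x ≤ y → ⟦ div ⟧ x k ≤ ⟦ div ⟧ y k
  div-mono {x} {y} x≤y = subst₂ _≤_ (sym (div≡/ x k)) (sym (div≡/ y k)) (/-monoˡ-≤ k x≤y)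
    where instance _ = >-nonZero 0<k

  -- Comparing packed numbers suffices: division by k is monotone and removes the order times.
  value-≤ : ∀ r c {j} → j < k → value (suc r) c ≤ value r (c + weight r j)
  value-≤ r c {j} j<k = ≤-trans
    (div-mono (minimum-≤ (λ j → value r (c + weight r j) * k + j) k j<k))
    (≤-reflexive (div-*+ _ k j j<k))

  value-zero : ∀ c → value 0 c ≡ maxDigit B k c
  value-zero c = trans (cong (λ x → ⟦ div ⟧ x k) (sym (+-identityʳ _))) (div-*+ _ k 0 0<k)

  value-lower : ∀ φ → (∀ i → φ i < k) → ∀ r c → value r c ≤ maxDigit B k (final φ r c)
  value-lower φ φ<k zero    c = ≤-reflexive (value-zero c)
  value-lower φ φ<k (suc r) c = ≤-trans (value-≤ r c (φ<k r)) (value-lower φ φ<k r _)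

  -- Entries of array 4 below r are still to be overwritten. The last clause therefore speaks of
  -- every ψ that agrees with the array from r on, and all of them lead from code 0 in layer n to c
  -- in layer r.
  Tracing : ℕ → State → Set
  Tracing r σ = envOf σ ≡ E × r ≤ n × Table (suc n * M) σ × ∃[ c ]
    reg σ 4 ≡ r * M + c × Fits r c × value r c ≡ value n 0 ×
    (∀ ψ → (∀ i → r ≤ i → ψ i ≡ arr σ 4 i) → final ψ n 0 ≡ final ψ r c)

  trace-body : ∀ {r σ} → Tracing (suc r) σ →
    reg σ 3 < suc (reg σ 4) × Ends chooseItem σ (Tracing r)
  trace-body {r} {σ} (refl , r<n , table , c , pos , fits , best , traced) =
    s≤s (subst (M ≤_) (sym pos) (≤-trans (m≤m+n M (r * M)) (m≤m+n _ c))) ,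
    seq-ends {Q = _≡ σ₁} (assign-ends 5 _ refl) λ { refl →
    seq-ends {Q = _≡ σ₂} (write-ends 4 itemE (var 5) refl) λ { refl →
    assign-ends 4 _
      (refl , <⇒≤ r<n , table , c + weight r j , pos′ , fits j<k ,
       trans (sym (proj₂ (pack-attained r c))) best , traced′) } }
    where
    j = choice (suc r) c
    j<k = proj₁ (pack-attained r c)
    v = eval σ (remE (read 3 (var 4)) (lit k))
    σ₁ = setReg 5 v σ
    σ₂ = setArr 4 (eval σ itemE) v σ₁
    c<M = code-fits (suc r) c fits
    v≡j : v ≡ j
    v≡j = cong (λ x → rem x k) (trans (cong (arr σ 3) pos) (table (suc r) c
      (<-≤-trans (+-monoʳ-< (suc r * M) c<M)
        (≤-trans (≤-reflexive (+-comm (suc r * M) M)) (*-monoˡ-≤ M (s≤s r<n)))) fits))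
    item : eval σ itemE ≡ r
    item = cong (_∸ 1) (trans (cong (λ q → ⟦ div ⟧ q M) pos) (div-*+ (suc r) M c c<M))
    pos′ : reg σ 4 ∸ M + eval σ₂ (weightE itemE (var 5)) ≡ r * M + (c + weight r j)
    pos′ = trans (cong₂ _+_
      (trans (cong (_∸ M) (trans pos (+-assoc M (r * M) c))) (m+n∸m≡n M (r * M + c)))
      (trans (eval-code σ₂ _ k) (cong₂ weight item v≡j))) (+-assoc (r * M) c _)
    traced′ : ∀ ψ → (∀ i → r ≤ i → ψ i ≡ arr σ₂ 4 i) →
              final ψ n 0 ≡ final ψ r (c + weight r j)
    traced′ ψ agree = trans
      (traced ψ λ i r<i → trans (agree i (<⇒≤ r<i))
        (update-≢ (arr σ 4) (eval σ itemE) λ eq → <⇒≢ r<i (sym (trans eq item))))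
      (cong (λ j → final ψ r (c + weight r j))
        (trans (agree r ≤-refl) (trans (update-≡ (arr σ 4) (eval σ itemE) (sym item)) v≡j)))

  trace-exit : ∀ {σ} → Tracing 0 σ → ¬ reg σ 3 < suc (reg σ 4)
  trace-exit (refl , _ , _ , c , pos , c<M , _) M<1+p =
    <⇒≱ c<M (subst (M ≤_) pos (≤-pred M<1+p))

  Traced : (ℕ → ℕ) → Set
  Traced φ = value n 0 ≡ maxDigit B k (final φ n 0)

  tracing-traced : ∀ {σ} → Tracing 0 σ → Traced (arr σ 4)
  tracing-traced (_ , _ , _ , c , _ , _ , best , traced) = trans (sym best)
    (trans (value-zero c) (cong (maxDigit B k) (sym (traced _ λ _ _ → refl))))

  outputAt : (ℕ → ℕ) → ℕ → ℕ
  outputAt φ q = ordered φ (⟦ div ⟧ q k) (rem q k)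

  Writing : (ℕ → ℕ) → ℕ → State → Set
  Writing φ i σ = envOf σ ≡ E × arr σ 4 ≡ φ × reg σ 4 + i ≡ n * k ×
    (∀ q → q < reg σ 4 → arr σ 2 q ≡ outputAt φ q)

  write-body : ∀ {φ i σ} → Writing φ (suc i) σ →
    reg σ 4 < reg σ 0 * k × Ends writeEntry σ (Writing φ i)
  write-body {φ} {i} {σ} (refl , refl , count , written) =
    m+n≤o⇒m≤o (suc p) (≤-reflexive count′) ,
    seq-ends {Q = _≡ σ₁} (write-ends 2 _ _ refl) λ { refl →
    assign-ends 4 _ (refl , refl , trans (cong (_+ i) (+-comm p 1)) count′ , written′) }
    where
    p = reg σ 4
    σ₁ = setArr 2 p (outputAt φ p) σ
    count′ : suc p + i ≡ n * k
    count′ = trans (sym (+-suc p i)) count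
    written′ : ∀ q → q < p + 1 → arr σ₁ 2 q ≡ outputAt φ q
    written′ q q<p+1 with q ≟ p
    ... | yes refl = update-≡ (arr σ 2) p refl
    ... | no  ne   = trans (update-≢ (arr σ 2) p ne)
      (written q (≤∧≢⇒< (≤-pred (subst (q <_) (+-comm p 1) q<p+1)) ne))

  -- S, D and M are not yet in their registers, so `envOf σ ≡ E` cannot serve as part of this
  -- invariant.
  Summing : ℕ → State → Set
  Summing i σ = arr σ 0 ≡ cyc × arr σ 1 ≡ siz × reg σ 0 ≡ n ×
    reg σ 4 + i ≡ n × reg σ 1 ≡ sumTo siz (reg σ 4)

  sum-body : ∀ {i σ} → Summing (suc i) σ → reg σ 4 < reg σ 0 × Ends addSize σ (Summing i)
  sum-body {i} {σ} (refl , refl , refl , count , sum) =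
    m+n≤o⇒m≤o (suc p) (≤-reflexive count′) ,
    seq-ends {Q = _≡ σ₁} (assign-ends 1 _ refl) λ { refl →
    assign-ends 4 _ (refl , refl , refl , trans (cong (_+ i) (+-comm p 1)) count′ ,
      trans (cong (_+ siz p) sum) (cong (sumTo siz) (+-comm 1 p))) }
    where
    p = reg σ 4
    σ₁ = setReg 1 (reg σ 1 + siz p) σ
    count′ : suc p + i ≡ n
    count′ = trans (sym (+-suc p i)) count

  exit-≡ : ∀ {p q} → p + 0 ≡ q → ¬ p < q
  exit-≡ {p} eq p<q = <-irrefl (trans (sym (+-identityʳ p)) eq) p<q

  module _ (S≡ : S ≡ sumTo siz n) (M≡ : M ≡ B ^ k) (fits : Fits n 0) (0<n : 0 < n) where

    open Scaled (n * M) (*-mono-≤ 0<n 0<M)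

    n≤X : n ≤ 1 * (n * M)
    n≤X = subst (n ≤_) (sym (*-identityˡ (n * M)))
                (subst (_≤ n * M) (*-identityʳ n) (*-monoʳ-≤ n 0<M))

    Ready : State → Set
    Ready σ = mkEnv (arr σ 0) (arr σ 1) (reg σ 0) (reg σ 1) (reg σ 2) M ≡ E

    sum-ready : ∀ {m σ} → D ≡ k * m * n → Summing 0 σ → Ends (setScale m) σ Ready
    sum-ready {σ = σ} D≡ (refl , refl , refl , count , sum) = assign-ends 2 _
      (cong₂ (λ S D → mkEnv cyc siz n S D M)
        (trans sum (trans (cong (sumTo siz) (trans (sym (+-identityʳ _)) count)) (sym S≡)))
        (sym D≡))

    initialise-filling : ∀ {σ} → Ready σ → Ends initialise σ (Filling (suc n * M))
    initialise-filling {σ} ready = seq-ends {Q = λ τ → envOf τ ≡ E}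
      (assign-ends 3 _ (trans (cong (mkEnv _ _ _ _ _)
        (trans (eval-pow σ k) (trans (cong (λ D → suc D ^ k) (cong Env.D ready)) (sym M≡)))) ready))
      λ env → assign-ends 4 (lit 0) (env , refl , λ _ _ ())

    filled-tracing : ∀ {σ} → Filling 0 σ → Ends toAnswer σ (Tracing n)
    filled-tracing {σ} (refl , count , table) = assign-ends 4 _
      (refl , ≤-refl ,
       subst (λ p → Table p σ) (trans (sym (+-identityʳ _)) count) table ,
       0 , sym (+-identityʳ _) , fits , refl , λ _ _ → refl)

    Optimal : State → Set
    Optimal τ = ∃[ φ ] Traced φ × (∀ q → q < n * k → arr τ 2 q ≡ outputAt φ q)

    written-optimal : ∀ {φ σ} → Traced φ → Writing φ 0 σ → Optimal σ
    written-optimal traced (_ , _ , count , written) =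
      _ , traced , λ q q< → written q (subst (q <_) (trans (sym count) (+-identityʳ _)) q<)

    program-halts : ∀ m → D ≡ k * m * n → ∀ {σ} → Summing n σ →
      Halts (program m) σ Optimal (sum factors * (n * M))
    program-halts m D≡ summing = halts {as = factors} (
      while-scaled Summing sum-body
        (λ { (_ , _ , refl , count , _) → exit-≡ count }) 1 n≤X summing and-then λ summed →
      ends-scaled (sum-ready {m} D≡ summed) and-then λ ready →
      ends-scaled (initialise-filling ready) and-then λ filling →
      while-scaled Filling fill-body
        (λ { (refl , count , _) → exit-≡ count }) 2 1+n*M≤X filling and-then λ filled →
      ends-scaled (filled-tracing filled) and-then λ tracing →
      while-scaled Tracing trace-body (λ {τ} → trace-exit {τ}) 1 n≤X tracing and-then λ {τ} traced →
      ends-scaled {Q = Writing (arr τ 4) (n * k)} (assign-ends 4 (lit 0)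
        (proj₁ traced , refl , refl , λ _ ())) and-then λ writing →
      finally (map-halts (λ {υ} → written-optimal {σ = υ} (tracing-traced {τ} traced))
        (while-scaled (Writing (arr τ 4)) write-body
          (λ { (refl , _ , count , _) → exit-≡ count }) k n*k≤X writing)))
      where
      1+n*M≤X : suc n * M ≤ 2 * (n * M)
      1+n*M≤X = +-mono-≤ (≤-trans (≤-reflexive (sym (*-identityˡ M))) (*-monoˡ-≤ M 0<n))
                         (≤-reflexive (sym (+-identityʳ (n * M))))
      n*k≤X : n * k ≤ k * (n * M)
      n*k≤X = ≤-trans (≤-reflexive (*-comm n k))
        (*-monoʳ-≤ k (≤-trans n≤X (≤-reflexive (*-identityˡ (n * M)))))

-- Sums of rounded levels as codes without carries.

div*≤ : ∀ m n → ⟦ div ⟧ m n * n ≤ m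
div*≤ m zero      = z≤n
div*≤ m n@(suc _) = m/n*n≤m m n

<div* : ∀ m n → 0 < n → m < suc (⟦ div ⟧ m n) * n
<div* m n@(suc _) _ = ≤-trans
  (≤-reflexive (cong suc (m≡m%n+[m/n]*n m n))) (+-monoˡ-≤ _ (m%n<n m n))

sumTo-cons : ∀ f r → sumTo f (suc r) ≡ f 0 + sumTo (f ∘ suc) r
sumTo-cons f zero    = +-comm 0 (f 0)
sumTo-cons f (suc r) = trans (cong (_+ f (suc r)) (sumTo-cons f r)) (+-assoc (f 0) _ _)

code-cong : ∀ B {u v} l → (∀ ℓ → u ℓ ≡ v ℓ) → code B u l ≡ code B v l
code-cong B zero    u≗v = refl
code-cong B (suc l) u≗v = cong₂ (λ a b → a + B * b) (u≗v 0) (code-cong B l (u≗v ∘ suc))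

-- A code is linear in its digits, whether or not these are below B; the bound matters only for
-- reading the digits back.
code-+ : ∀ B u v l → code B (λ ℓ → u ℓ + v ℓ) l ≡ code B u l + code B v l
code-+ B u v zero    = refl
code-+ B u v (suc l) = begin
  u 0 + v 0 + B * code B (λ ℓ → u (suc ℓ) + v (suc ℓ)) l
    ≡⟨ cong (λ x → u 0 + v 0 + B * x) (code-+ B (u ∘ suc) (v ∘ suc) l) ⟩
  u 0 + v 0 + B * (code B (u ∘ suc) l + code B (v ∘ suc) l)
    ≡⟨ solve 5 (λ a b B c d → a :+ b :+ B :* (c :+ d) := (a :+ B :* c) :+ (b :+ B :* d)) refl
         (u 0) (v 0) B _ _ ⟩
  u 0 + B * code B (u ∘ suc) l + (v 0 + B * code B (v ∘ suc) l) ∎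
  where
  open ≡-Reasoning
  open +-*-Solver

code-zero : ∀ B l → code B (λ _ → 0) l ≡ 0
code-zero B zero    = refl
code-zero B (suc l) = trans (cong (B *_) (code-zero B l)) (*-zeroʳ B)

code-< : ∀ B u l → (∀ ℓ → u ℓ < B) → code B u l < B ^ l
code-< B u zero    u<B = s≤s z≤n
code-< B u (suc l) u<B = begin-strict
  u 0 + B * code B (u ∘ suc) l  <⟨ +-monoˡ-< _ (u<B 0) ⟩
  B + B * code B (u ∘ suc) l    ≡⟨ *-suc B _ ⟨
  B * suc (code B (u ∘ suc) l)  ≤⟨ *-monoʳ-≤ B (code-< B (u ∘ suc) l (u<B ∘ suc)) ⟩
  B * B ^ l                     ∎
  where open ≤-Reasoning

maxDigit-suc : ∀ B u l → (∀ ℓ → u ℓ < B) →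
  maxDigit B (suc l) (code B u (suc l)) ≡ u 0 ⊔ maxDigit B l (code B (u ∘ suc) l)
maxDigit-suc B u l u<B = trans
  (cong₂ (λ d y → d + (maxDigit B l y ∸ d))
    (trans (cong (λ x → rem x B) swap) (rem-*+ c B (u 0) (u<B 0)))
    (trans (cong (λ x → ⟦ div ⟧ x B) swap) (div-*+ c B (u 0) (u<B 0))))
  (m+[n∸m]≡m⊔n (u 0) _)
  where
  c = code B (u ∘ suc) l
  swap : u 0 + B * c ≡ c * B + u 0
  swap = trans (+-comm (u 0) (B * c)) (cong (_+ u 0) (*-comm B c))

≤-maxDigit : ∀ B u l → (∀ ℓ → u ℓ < B) → ∀ {ℓ} → ℓ < l → u ℓ ≤ maxDigit B l (code B u l)
≤-maxDigit B u (suc l) u<B {zero}  ℓ<l =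
  ≤-trans (m≤m⊔n (u 0) _) (≤-reflexive (sym (maxDigit-suc B u l u<B)))
≤-maxDigit B u (suc l) u<B {suc ℓ} ℓ<l =
  ≤-trans (≤-maxDigit B (u ∘ suc) l (u<B ∘ suc) (≤-pred ℓ<l))
    (≤-trans (m≤n⊔m (u 0) _) (≤-reflexive (sym (maxDigit-suc B u l u<B))))

maxDigit-attained : ∀ B u l → (∀ ℓ → u ℓ < B) → 0 < l →
  ∃[ ℓ ] ℓ < l × maxDigit B l (code B u l) ≡ u ℓ
maxDigit-attained B u (suc zero)    u<B _ = 0 , s≤s z≤n , trans (maxDigit-suc B u 0 u<B) (⊔-identityʳ _)
maxDigit-attained B u (suc (suc l)) u<B _
  with ⊔-sel (u 0) (maxDigit B (suc l) (code B (u ∘ suc) (suc l)))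
     | maxDigit-attained B (u ∘ suc) (suc l) (u<B ∘ suc) (s≤s z≤n)
... | inj₁ eq | _            = 0 , s≤s z≤n , trans (maxDigit-suc B u (suc l) u<B) eq
... | inj₂ eq | ℓ , ℓ<l , at = suc ℓ , s≤s ℓ<l ,
  trans (maxDigit-suc B u (suc l) u<B) (trans eq at)

module Rounding (k : ℕ) (0<k : 0 < k) (E : Env)
  (cyc>0 : ∀ i → i < Env.n E → 0 < Env.cyc E i)
  (S≡ : Env.S E ≡ sumTo (Env.siz E) (Env.n E)) (0<S : 0 < Env.S E)
  (M≡ : Env.M E ≡ suc (Env.D E) ^ k) where

  open Env E
  open Model k E

  0<M : 0 < M
  0<M = subst (0 <_) (sym M≡) (m^n>0 B k)

  open Correctness k 0<k E 0<M

  digit-≤ : ∀ {i} j ℓ → i < n → digit i j ℓ * S ≤ siz i * D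
  digit-≤ {i} j ℓ i<n = *-cancelˡ-≤ (cyc i) (begin
    cyc i * (digit i j ℓ * S)     ≡⟨ solve 3 (λ c d s → c :* (d :* s) := d :* (c :* s)) refl (cyc i) (digit i j ℓ) S ⟩
    digit i j ℓ * (cyc i * S)     ≤⟨ div*≤ _ (cyc i * S) ⟩
    (cyc i ∸ age i j ℓ) * siz i * D  ≤⟨ *-monoˡ-≤ D (*-monoˡ-≤ (siz i) (m∸n≤m (cyc i) (age i j ℓ))) ⟩
    cyc i * siz i * D             ≡⟨ *-assoc (cyc i) (siz i) D ⟩
    cyc i * (siz i * D)           ∎)
    where
    open ≤-Reasoning
    open +-*-Solver
    instance _ = >-nonZero (cyc>0 i i<n)

  -- The bound is a budget: item r can use up at most `siz r * D` of `S * D` at each time, by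
  -- `digit-≤`. Once no item is left, cancelling S gives digits of at most D.
  fits-code : ∀ r u → r ≤ n → (∀ ℓ → u ℓ * S + sumTo siz r * D ≤ S * D) → Fits r (code B u k)
  fits-code zero u r≤n bound = subst (code B u k <_) (sym M≡) (code-< B u k λ ℓ →
    s≤s (*-cancelʳ-≤ (u ℓ) D S (≤-trans (m+n≤o⇒m≤o _ (bound ℓ)) (≤-reflexive (*-comm S D)))))
    where instance _ = >-nonZero 0<S
  fits-code (suc r) u r<n bound {j} j<k =
    subst (Fits r) (code-+ B u (digit r j) k) (fits-code r _ (<⇒≤ r<n) λ ℓ → begin
      (u ℓ + digit r j ℓ) * S + sumTo siz r * D
        ≡⟨ solve 4 (λ u d S y → (u :+ d) :* S :+ y := u :* S :+ (y :+ d :* S)) refl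
             (u ℓ) (digit r j ℓ) S (sumTo siz r * D) ⟩
      u ℓ * S + (sumTo siz r * D + digit r j ℓ * S)
        ≤⟨ +-monoʳ-≤ (u ℓ * S) (+-monoʳ-≤ (sumTo siz r * D) (digit-≤ j ℓ r<n)) ⟩
      u ℓ * S + (sumTo siz r * D + siz r * D)
        ≡⟨ cong (u ℓ * S +_) (*-distribʳ-+ D (sumTo siz r) (siz r)) ⟨
      u ℓ * S + sumTo siz (suc r) * D
        ≤⟨ bound ℓ ⟩
      S * D ∎)
    where
    open ≤-Reasoning
    open +-*-Solver

  fits : Fits n 0
  fits = subst (Fits n) (code-zero B k)
    (fits-code n (λ _ → 0) ≤-refl λ ℓ → ≤-reflexive (cong (_* D) (sym S≡)))

  roundedLevel : (ℕ → ℕ) → ℕ → ℕ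
  roundedLevel φ ℓ = sumTo (λ i → digit i (φ i) ℓ) n

  -- The digits u of the initial code are arbitrary, so that the induction can absorb the choice for
  -- item r into them.
  final-code : ∀ φ r u → final φ r (code B u k) ≡
               code B (λ ℓ → u ℓ + sumTo (λ i → digit i (φ i) ℓ) r) k
  final-code φ zero    u = code-cong B k λ ℓ → sym (+-identityʳ (u ℓ))
  final-code φ (suc r) u = begin
    final φ r (code B u k + weight r (φ r))
      ≡⟨ cong (final φ r) (code-+ B u (digit r (φ r)) k) ⟨
    final φ r (code B (λ ℓ → u ℓ + digit r (φ r) ℓ) k)
      ≡⟨ final-code φ r _ ⟩
    code B (λ ℓ → u ℓ + digit r (φ r) ℓ + sumTo (λ i → digit i (φ i) ℓ) r) k
      ≡⟨ code-cong B k (λ ℓ → trans (+-assoc (u ℓ) _ _) (cong (u ℓ +_) (+-comm (digit r (φ r) ℓ) _))) ⟩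
    code B (λ ℓ → u ℓ + sumTo (λ i → digit i (φ i) ℓ) (suc r)) k ∎
    where open ≡-Reasoning

  final-roundedLevel : ∀ φ → final φ n 0 ≡ code B (roundedLevel φ) k
  final-roundedLevel φ = trans (cong (final φ n) (sym (code-zero B k))) (final-code φ n (λ _ → 0))

  roundedLevel-< : ∀ φ ℓ → roundedLevel φ ℓ < B
  roundedLevel-< φ ℓ = s≤s (*-cancelʳ-≤ (roundedLevel φ ℓ) D S (begin
    roundedLevel φ ℓ * S  ≤⟨ go n ≤-refl ⟩
    sumTo siz n * D       ≡⟨ cong (_* D) S≡ ⟨
    S * D                 ≡⟨ *-comm S D ⟩
    D * S                 ∎))
    where
    open ≤-Reasoning
    instance _ = >-nonZero 0<S
    go : ∀ r → r ≤ n → sumTo (λ i → digit i (φ i) ℓ) r * S ≤ sumTo siz r * D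
    go zero    _   = z≤n
    go (suc r) r<n = begin
      (sumTo _ r + digit r (φ r) ℓ) * S    ≡⟨ *-distribʳ-+ S (sumTo _ r) _ ⟩
      sumTo _ r * S + digit r (φ r) ℓ * S  ≤⟨ +-mono-≤ (go r (<⇒≤ r<n)) (digit-≤ (φ r) ℓ r<n) ⟩
      sumTo siz r * D + siz r * D          ≡⟨ *-distribʳ-+ D (sumTo siz r) (siz r) ⟨
      (sumTo siz r + siz r) * D            ∎

  -- Both peaks are compared with `value n 0`, which φ attains and which is a lower bound for ψ. The
  -- witness ℓ′ is a time at which the rounded levels of ψ peak.
  traced-optimal : ∀ {φ} → Traced φ → ∀ ψ → (∀ i → ψ i < k) →
    ∃[ ℓ′ ] ℓ′ < k × (∀ {ℓ} → ℓ < k → roundedLevel φ ℓ ≤ roundedLevel ψ ℓ′)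
  traced-optimal {φ} traced ψ ψ<k
    with ℓ′ , ℓ′<k , at ← maxDigit-attained B (roundedLevel ψ) k (roundedLevel-< ψ) 0<k
    = ℓ′ , ℓ′<k , λ {ℓ} ℓ<k → begin
    roundedLevel φ ℓ                        ≤⟨ ≤-maxDigit B (roundedLevel φ) k (roundedLevel-< φ) ℓ<k ⟩
    maxDigit B k (code B (roundedLevel φ) k)  ≡⟨ cong (maxDigit B k) (final-roundedLevel φ) ⟨
    maxDigit B k (final φ n 0)              ≡⟨ traced ⟨
    value n 0                               ≤⟨ value-lower ψ ψ<k n 0 ⟩
    maxDigit B k (final ψ n 0)              ≡⟨ trans (cong (maxDigit B k) (final-roundedLevel ψ)) at ⟩
    roundedLevel ψ ℓ′                       ∎
    where open ≤-Reasoning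

-- Natural numbers as rationals.

toℚᵘ-/ : ∀ i d → ℚ.toℚᵘ (i ℚ./ suc d) ℚᵘ.≃ ℚᵘ.mkℚᵘ i d
toℚᵘ-/ i d = ℚ.toℚᵘ-fromℚᵘ (ℚᵘ.mkℚᵘ i d)

fromℕ-+ : ∀ a b → fromℕ (a + b) ≡ fromℕ a ℚ.+ fromℕ b
fromℕ-+ a b = ℚ.toℚᵘ-injective (begin
  ℚ.toℚᵘ (fromℕ (a + b))                      ≈⟨ toℚᵘ-/ (ℤ.+ (a + b)) 0 ⟩
  ℚᵘ.mkℚᵘ (ℤ.+ (a + b)) 0                     ≈⟨ ℚᵘ.*≡* (cong (ℤ._* ℤ.1ℤ) (sym
    (cong₂ ℤ._+_ (ℤ.*-identityʳ (ℤ.+ a)) (ℤ.*-identityʳ (ℤ.+ b))))) ⟩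
  ℚᵘ.mkℚᵘ (ℤ.+ a) 0 ℚᵘ.+ ℚᵘ.mkℚᵘ (ℤ.+ b) 0    ≈⟨ ℚᵘ.+-cong (toℚᵘ-/ (ℤ.+ a) 0) (toℚᵘ-/ (ℤ.+ b) 0) ⟨
  ℚ.toℚᵘ (fromℕ a) ℚᵘ.+ ℚ.toℚᵘ (fromℕ b)      ≈⟨ ℚ.toℚᵘ-homo-+ (fromℕ a) (fromℕ b) ⟨
  ℚ.toℚᵘ (fromℕ a ℚ.+ fromℕ b)                ∎)
  where open ℚᵘ.≃-Reasoning

/-*-/ : ∀ i j c d → (i ℚ./ suc c) ℚ.* (j ℚ./ suc d) ≡ (i ℤ.* j) ℚ./ (suc c * suc d)
/-*-/ i j c d = ℚ.toℚᵘ-injective (begin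
  ℚ.toℚᵘ ((i ℚ./ suc c) ℚ.* (j ℚ./ suc d))             ≈⟨ ℚ.toℚᵘ-homo-* (i ℚ./ suc c) (j ℚ./ suc d) ⟩
  ℚ.toℚᵘ (i ℚ./ suc c) ℚᵘ.* ℚ.toℚᵘ (j ℚ./ suc d)       ≈⟨ ℚᵘ.*-cong (toℚᵘ-/ i c) (toℚᵘ-/ j d) ⟩
  ℚᵘ.mkℚᵘ i c ℚᵘ.* ℚᵘ.mkℚᵘ j d                         ≈⟨ toℚᵘ-/ (i ℤ.* j) (d + c * suc d) ⟨
  ℚ.toℚᵘ ((i ℤ.* j) ℚ./ (suc c * suc d))               ∎)
  where open ℚᵘ.≃-Reasoning

fromℕ-* : ∀ a b → fromℕ (a * b) ≡ fromℕ a ℚ.* fromℕ b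
fromℕ-* a b = trans (cong (ℚ._/ 1) (ℤ.pos-* a b)) (sym (/-*-/ (ℤ.+ a) (ℤ.+ b) 0 0))

fromℕ-^ : ∀ a l → fromℕ (a ^ l) ≡ fromℕ a ^ℚ l
fromℕ-^ a zero    = refl
fromℕ-^ a (suc l) = trans (fromℕ-* a (a ^ l)) (cong (fromℕ a ℚ.*_) (fromℕ-^ a l))

fromℕ-mono : ∀ {a b} → a ≤ b → fromℕ a ℚ.≤ fromℕ b
fromℕ-mono {a} {b} a≤b = ℚ.toℚᵘ-cancel-≤
  (ℚᵘ.≤-respˡ-≃ (ℚᵘ.≃-sym (toℚᵘ-/ (ℤ.+ a) 0)) (ℚᵘ.≤-respʳ-≃ (ℚᵘ.≃-sym (toℚᵘ-/ (ℤ.+ b) 0))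
    (ℚᵘ.*≤* (ℤ.*-monoʳ-≤-nonNeg ℤ.1ℤ (ℤ.+≤+ a≤b)))))

0≤fromℕ : ∀ a → 0ℚ ℚ.≤ fromℕ a
0≤fromℕ a = fromℕ-mono {0} {a} z≤n

*-mono-fromℕ : ∀ {x y} a → x ℚ.≤ y → x ℚ.* fromℕ a ℚ.≤ y ℚ.* fromℕ a
*-mono-fromℕ a = ℚ.*-monoʳ-≤-nonNeg (fromℕ a) ⦃ ℚ.normalize-nonNeg a 1 ⦄

0≤* : ∀ {x y} → 0ℚ ℚ.≤ x → 0ℚ ℚ.≤ y → 0ℚ ℚ.≤ x ℚ.* y
0≤* {x} {y} 0≤x 0≤y = subst (ℚ._≤ x ℚ.* y) (ℚ.*-zeroʳ x)
  (ℚ.*-monoˡ-≤-nonNeg x ⦃ ℚ.nonNegative 0≤x ⦄ 0≤y)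

fromℕ-positive : ∀ {a} → 0 < a → Positive (fromℕ a)
fromℕ-positive {suc a} _ = ℚ.normalize-pos (suc a) 1

/-*-fromℕ : ∀ a c .⦃ _ : NonZero c ⦄ → (ℤ.+ a ℚ./ c) ℚ.* fromℕ c ≡ fromℕ a
/-*-fromℕ a c@(suc d) = trans (/-*-/ (ℤ.+ a) (ℤ.+ c) d 0)
  (ℚ.fromℚᵘ-cong {ℚᵘ.mkℚᵘ (ℤ.+ a ℤ.* ℤ.+ c) (d * 1)} {ℚᵘ.mkℚᵘ (ℤ.+ a) 0} (ℚᵘ.*≡*
    (trans (ℤ.*-assoc (ℤ.+ a) (ℤ.+ c) ℤ.1ℤ) (cong (ℤ.+ a ℤ.*_) (sym (ℤ.pos-* c 1))))))

-- Clears denominators; for levels, c is the cycle length.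
≤-from-multiples : ∀ {x y a b} c → 0 < c → x ℚ.* fromℕ c ≡ fromℕ a →
                   y ℚ.* fromℕ c ≡ fromℕ b → a ≤ b → x ℚ.≤ y
≤-from-multiples {x} {y} {a} {b} c 0<c xc≡a yc≡b a≤b = ℚ.*-cancelʳ-≤-pos (fromℕ c)
  ⦃ fromℕ-positive 0<c ⦄ (subst₂ ℚ._≤_ (sym xc≡a) (sym yc≡b) (fromℕ-mono a≤b))

sumℚ-mono : ∀ {l} {f g : Fin l → ℚ} → (∀ i → f i ℚ.≤ g i) → sumℚ f ℚ.≤ sumℚ g
sumℚ-mono {zero}  f≤g = ℚ.≤-refl
sumℚ-mono {suc l} f≤g = ℚ.+-mono-≤ (f≤g zero) (sumℚ-mono (f≤g ∘ suc))

sumℚ-* : ∀ {l} (f : Fin l → ℚ) c → sumℚ (λ i → f i ℚ.* c) ≡ sumℚ f ℚ.* c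
sumℚ-* {zero}  f c = sym (ℚ.*-zeroˡ c)
sumℚ-* {suc l} f c = trans (cong (f zero ℚ.* c ℚ.+_) (sumℚ-* (f ∘ suc) c))
                           (sym (ℚ.*-distribʳ-+ c (f zero) _))

fromℕ-sumTo : ∀ f l → fromℕ (sumTo f l) ≡ sumℚ {l} (λ i → fromℕ (f (toℕ i)))
fromℕ-sumTo f zero    = refl
fromℕ-sumTo f (suc l) = trans (cong fromℕ (sumTo-cons f l))
  (trans (fromℕ-+ (f 0) _) (cong (fromℕ (f 0) ℚ.+_) (fromℕ-sumTo (f ∘ suc) l)))

sumTo-suc : ∀ f l → sumTo (suc ∘ f) l ≡ sumTo f l + l
sumTo-suc f zero    = refl
sumTo-suc f (suc l) = begin
  sumTo (suc ∘ f) l + suc (f l)  ≡⟨ cong (_+ suc (f l)) (sumTo-suc f l) ⟩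
  sumTo f l + l + suc (f l)      ≡⟨ solve 3 (λ a l b → a :+ l :+ (con 1 :+ b) := a :+ b :+ (con 1 :+ l)) refl
                                      (sumTo f l) l (f l) ⟩
  sumTo f l + f l + suc l        ∎
  where
  open ≡-Reasoning
  open +-*-Solver

-- Rows with a single order.

Once : ∀ {c} → (Fin c → ℕ) → Fin c → Set
Once g f = g f ≡ 1 × (∀ j → j ≢ f → g j ≡ 0)

sumℕ-zero : ∀ {c} (g : Fin c → ℕ) → (∀ j → g j ≡ 0) → sumℕ g ≡ 0
sumℕ-zero {zero}  g g≡0 = refl
sumℕ-zero {suc c} g g≡0 = cong₂ _+_ (g≡0 zero) (sumℕ-zero (g ∘ suc) (g≡0 ∘ suc))

sumℕ≡0 : ∀ {c} (g : Fin c → ℕ) → sumℕ g ≡ 0 → ∀ j → g j ≡ 0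
sumℕ≡0 g eq zero    = m+n≡0⇒m≡0 (g zero) eq
sumℕ≡0 g eq (suc j) = sumℕ≡0 (g ∘ suc) (m+n≡0⇒n≡0 (g zero) eq) j

once⇒sum : ∀ {c} (g : Fin c → ℕ) f → Once g f → sumℕ g ≡ 1
once⇒sum g zero    (g≡1 , g≡0) = cong₂ _+_ g≡1 (sumℕ-zero (g ∘ suc) λ j → g≡0 (suc j) λ ())
once⇒sum g (suc f) (g≡1 , g≡0) = cong₂ _+_ (g≡0 zero λ ())
  (once⇒sum (g ∘ suc) f (g≡1 , λ j j≢f → g≡0 (suc j) (j≢f ∘ Fin.suc-injective)))

sum⇒once : ∀ {c} (g : Fin c → ℕ) → sumℕ g ≡ 1 → ∃[ f ] Once g f
sum⇒once {suc c} g eq with g zero in g₀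
... | 1     = zero , g₀ , λ { zero 0≢0 → contradiction refl 0≢0
                            ; (suc j) _ → sumℕ≡0 (g ∘ suc) (suc-injective eq) j }
... | zero with f , g≡1 , g≡0 ← sum⇒once (g ∘ suc) eq
    = suc f , g≡1 , λ { zero _ → g₀ ; (suc j) j≢f → g≡0 j (j≢f ∘ cong suc) }

once-sumℚ : ∀ {c} (g : Fin c → ℕ) f (h : Fin c → ℚ) → Once g f →
            sumℚ (λ j → fromℕ (g j) ℚ.* h j) ≡ h f
once-sumℚ g zero h (g≡1 , g≡0) = trans
  (cong₂ ℚ._+_ (trans (cong (λ a → fromℕ a ℚ.* h zero) g≡1) (ℚ.*-identityˡ (h zero)))
    (vanish (g ∘ suc) (h ∘ suc) λ j → g≡0 (suc j) λ ()))
  (ℚ.+-identityʳ (h zero))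
  where
  vanish : ∀ {c} (g : Fin c → ℕ) (h : Fin c → ℚ) → (∀ j → g j ≡ 0) →
           sumℚ (λ j → fromℕ (g j) ℚ.* h j) ≡ 0ℚ
  vanish {zero}  g h g≡0 = refl
  vanish {suc c} g h g≡0 = cong₂ ℚ._+_
    (trans (cong (λ a → fromℕ a ℚ.* h zero) (g≡0 zero)) (ℚ.*-zeroˡ (h zero)))
    (vanish (g ∘ suc) (h ∘ suc) (g≡0 ∘ suc))
once-sumℚ g (suc f) h (g≡1 , g≡0) = trans
  (cong₂ ℚ._+_ (trans (cong (λ a → fromℕ a ℚ.* h zero) (g≡0 zero λ ())) (ℚ.*-zeroˡ (h zero)))
    (once-sumℚ (g ∘ suc) f (h ∘ suc) (g≡1 , λ j j≢f → g≡0 (suc j) (j≢f ∘ Fin.suc-injective))))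
  (ℚ.+-identityˡ (h (suc f)))

padded-toℕ : ∀ {l} (f : Fin l → ℕ) i → padded f (toℕ i) ≡ f i
padded-toℕ {l} f i with toℕ i <? l
... | yes i<l = cong f (Fin.fromℕ<-toℕ i i<l)
... | no  i≮l = contradiction (Fin.toℕ<n i) i≮l

padded-< : ∀ {l k} (f : Fin l → ℕ) → 0 < k → (∀ i → f i < k) → ∀ p → padded f p < k
padded-< {l} f 0<k f<k p with p <? l
... | yes p<l = f<k (fromℕ< p<l)
... | no  _   = 0<k

-- Rounding error against the optimum.

module Analysis {k n : ℕ} .⦃ k≢0 : NonZero k ⦄ (0<n : 0 < n) (I : Instance k n) (m : ℕ) (0<m : 0 < m) where

  open Instance I

  private
    sizes : ℕ → ℕ
    sizes = padded reorder
    scale : ℕ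
    scale = k * m * n
    instance
      cycle≢0 : ∀ {i} → NonZero (cycle i)
      cycle≢0 = cycle-nonZero

  env : Env
  env = mkEnv (padded cycle) sizes n (sumTo sizes n) scale (suc scale ^ k)

  open Env env using (S; D)
  open Model k env

  0<k : 0 < k
  0<k = >-nonZero⁻¹ k

  padded-cycle : ∀ i → padded cycle (toℕ i) ≡ cycle i
  padded-cycle = padded-toℕ cycle

  0<cycle : ∀ i → 0 < cycle i
  0<cycle i = >-nonZero⁻¹ (cycle i)

  cyc>0 : ∀ i → i < n → 0 < padded cycle i
  cyc>0 i i<n = subst (λ p → 0 < padded cycle p) (Fin.toℕ-fromℕ< i<n)
    (subst (0 <_) (sym (padded-cycle (fromℕ< i<n))) (0<cycle _))

  0<S : 0 < S
  0<S = go n 0<n ≤-refl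
    where
    go : ∀ r → 0 < r → r ≤ n → 0 < sumTo sizes r
    go (suc r) _ r<n = ≤-trans
      (subst (λ p → 0 < sizes p) (Fin.toℕ-fromℕ< r<n)
        (subst (0 <_) (sym (padded-toℕ reorder (fromℕ< r<n))) (>-nonZero⁻¹ _ ⦃ reorder-nonZero ⦄)))
      (m≤n+m _ (sumTo sizes r))

  open Rounding k 0<k env cyc>0 refl 0<S refl
  open Correctness k 0<k env 0<M

  module _ (i : Fin n) (j : Fin (cycle i)) (ℓ : Fin k) where
    private
      c = cycle i
      s = reorder i
      r = (toℕ ℓ + (c ∸ toℕ j)) % c
      L = itemLevel I i j ℓ

    itemLevel-*-cycle : L ℚ.* fromℕ c ≡ fromℕ ((c ∸ r) * s)
    itemLevel-*-cycle = begin
      (ℤ.+ (c ∸ r) ℚ./ c) ℚ.* fromℕ s ℚ.* fromℕ c    ≡⟨ solve 3 (λ x y z → x :* y :* z := (x :* z) :* y) refl (ℤ.+ (c ∸ r) ℚ./ c) (fromℕ s) (fromℕ c) ⟩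
      (ℤ.+ (c ∸ r) ℚ./ c) ℚ.* fromℕ c ℚ.* fromℕ s    ≡⟨ cong (ℚ._* fromℕ s) (/-*-fromℕ (c ∸ r) c) ⟩
      fromℕ (c ∸ r) ℚ.* fromℕ s                      ≡⟨ fromℕ-* (c ∸ r) s ⟨
      fromℕ ((c ∸ r) * s)                            ∎
      where
      open ≡-Reasoning
      open ℚ-Solver

    itemLevel-*-cycle-* : ∀ a → L ℚ.* fromℕ a ℚ.* fromℕ c ≡ fromℕ ((c ∸ r) * s * a)
    itemLevel-*-cycle-* a = begin
      L ℚ.* fromℕ a ℚ.* fromℕ c        ≡⟨ solve 3 (λ x y z → x :* y :* z := (x :* z) :* y) refl L (fromℕ a) (fromℕ c) ⟩
      L ℚ.* fromℕ c ℚ.* fromℕ a        ≡⟨ cong (ℚ._* fromℕ a) itemLevel-*-cycle ⟩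
      fromℕ ((c ∸ r) * s) ℚ.* fromℕ a  ≡⟨ fromℕ-* ((c ∸ r) * s) a ⟨
      fromℕ ((c ∸ r) * s * a)          ∎
      where
      open ≡-Reasoning
      open ℚ-Solver

    reorder-≤ : fromℕ s ℚ.≤ L ℚ.* fromℕ k
    reorder-≤ = ≤-from-multiples c (0<cycle i) (sym (fromℕ-* s c)) (itemLevel-*-cycle-* k)
      (begin
        s * c              ≤⟨ *-monoʳ-≤ s (cycle≤k I i) ⟩
        s * k              ≡⟨ cong (_* k) (*-identityˡ s) ⟨
        1 * s * k          ≤⟨ *-monoˡ-≤ k (*-monoˡ-≤ s (m<n⇒0<n∸m (m%n<n (toℕ ℓ + (c ∸ toℕ j)) c))) ⟩
        (c ∸ r) * s * k    ∎)
      where open ≤-Reasoning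

    module _ {φ : ℕ} (φ≡j : φ % c ≡ toℕ j) where
      private
        d = digit (toℕ i) φ (toℕ ℓ)

      digit-≡ : d ≡ ⟦ div ⟧ ((c ∸ r) * s * D) (c * S)
      digit-≡ = trans (cong₂ (λ c′ s → ⟦ div ⟧ ((c′ ∸ rem (toℕ ℓ + (c′ ∸ rem φ c′)) c′) * s * D) (c′ * S))
          (padded-cycle i) (padded-toℕ reorder i))
        (cong (λ r → ⟦ div ⟧ ((c ∸ r) * s * D) (c * S))
          (trans (rem≡% _ c) (cong (λ b → (toℕ ℓ + (c ∸ b)) % c) (trans (rem≡% φ c) φ≡j))))

      digit-lower : fromℕ d ℚ.* fromℕ S ℚ.≤ L ℚ.* fromℕ D
      digit-lower = ≤-from-multiples c (0<cycle i)
        (trans (cong (ℚ._* fromℕ c) (sym (fromℕ-* d S))) (sym (fromℕ-* (d * S) c)))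
        (itemLevel-*-cycle-* D)
        (begin
          d * S * c                    ≡⟨ trans (*-assoc d S c) (cong (d *_) (*-comm S c)) ⟩
          d * (c * S)                  ≡⟨ cong (_* (c * S)) digit-≡ ⟩
          ⟦ div ⟧ _ (c * S) * (c * S)  ≤⟨ div*≤ ((c ∸ r) * s * D) (c * S) ⟩
          (c ∸ r) * s * D              ∎)
        where open ≤-Reasoning

      digit-upper : L ℚ.* fromℕ D ℚ.≤ fromℕ (suc d) ℚ.* fromℕ S
      digit-upper = ≤-from-multiples c (0<cycle i)
        (itemLevel-*-cycle-* D)
        (trans (cong (ℚ._* fromℕ c) (sym (fromℕ-* (suc d) S))) (sym (fromℕ-* (suc d * S) c)))
        (begin
          (c ∸ r) * s * D                    ≤⟨ <⇒≤ (<div* ((c ∸ r) * s * D) (c * S) (*-mono-≤ (0<cycle i) 0<S)) ⟩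
          suc (⟦ div ⟧ ((c ∸ r) * s * D) (c * S)) * (c * S)  ≡⟨ cong (λ x → suc x * (c * S)) digit-≡ ⟨
          suc d * (c * S)                    ≡⟨ trans (cong (suc d *_) (*-comm c S)) (sym (*-assoc (suc d) S c)) ⟩
          suc d * S * c                      ∎)
        where open ≤-Reasoning

  -- Applied twice: to the output, with φ the traced order times, and to `optimal`, with φ read off
  -- its first cycles.
  module Offsets (x : Matrix k n) (φ : ℕ → ℕ) (f : ∀ i → Fin (cycle i))
    (φ≡f : ∀ i → φ (toℕ i) % cycle i ≡ toℕ (f i))
    (once : ∀ i → Once (firstCycle I x i) (f i)) where

    level-≡ : ∀ ℓ → level I x ℓ ≡ sumℚ λ i → itemLevel I i (f i) ℓ
    level-≡ ℓ = Sum.sum-cong-≗ ℚ.+-0-monoid λ i →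
      once-sumℚ (firstCycle I x i) (f i) (λ j → itemLevel I i j ℓ) (once i)

    size-≤ : ∀ ℓ → fromℕ S ℚ.≤ level I x ℓ ℚ.* fromℕ k
    size-≤ ℓ = begin
      fromℕ S                                              ≡⟨ fromℕ-sumTo sizes n ⟩
      sumℚ {n} (λ i → fromℕ (sizes (toℕ i)))                   ≤⟨ sumℚ-mono (λ i → subst (λ s → fromℕ s ℚ.≤ _) (sym (padded-toℕ reorder i)) (reorder-≤ i (f i) ℓ)) ⟩
      sumℚ (λ i → itemLevel I i (f i) ℓ ℚ.* fromℕ k)       ≡⟨ sumℚ-* (λ i → itemLevel I i (f i) ℓ) (fromℕ k) ⟩
      sumℚ (λ i → itemLevel I i (f i) ℓ) ℚ.* fromℕ k       ≡⟨ cong (ℚ._* fromℕ k) (level-≡ ℓ) ⟨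
      level I x ℓ ℚ.* fromℕ k                              ∎
      where open ℚ.≤-Reasoning

    rounded-lower : ∀ ℓ → fromℕ (roundedLevel φ (toℕ ℓ)) ℚ.* fromℕ S ℚ.≤ level I x ℓ ℚ.* fromℕ D
    rounded-lower ℓ = begin
      fromℕ (roundedLevel φ (toℕ ℓ)) ℚ.* fromℕ S           ≡⟨ cong (ℚ._* fromℕ S) (fromℕ-sumTo (λ i → digit i (φ i) (toℕ ℓ)) n) ⟩
      sumℚ (λ i → fromℕ (d i)) ℚ.* fromℕ S                 ≡⟨ sumℚ-* (λ i → fromℕ (d i)) (fromℕ S) ⟨
      sumℚ (λ i → fromℕ (d i) ℚ.* fromℕ S)                 ≤⟨ sumℚ-mono (λ i → digit-lower i (f i) ℓ (φ≡f i)) ⟩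
      sumℚ (λ i → itemLevel I i (f i) ℓ ℚ.* fromℕ D)       ≡⟨ sumℚ-* (λ i → itemLevel I i (f i) ℓ) (fromℕ D) ⟩
      sumℚ (λ i → itemLevel I i (f i) ℓ) ℚ.* fromℕ D       ≡⟨ cong (ℚ._* fromℕ D) (level-≡ ℓ) ⟨
      level I x ℓ ℚ.* fromℕ D                              ∎
      where
      open ℚ.≤-Reasoning
      d : Fin n → ℕ
      d i = digit (toℕ i) (φ (toℕ i)) (toℕ ℓ)

    rounded-upper : ∀ ℓ → level I x ℓ ℚ.* fromℕ D ℚ.≤ fromℕ (roundedLevel φ (toℕ ℓ) + n) ℚ.* fromℕ S
    rounded-upper ℓ = begin
      level I x ℓ ℚ.* fromℕ D                              ≡⟨ cong (ℚ._* fromℕ D) (level-≡ ℓ) ⟩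
      sumℚ (λ i → itemLevel I i (f i) ℓ) ℚ.* fromℕ D       ≡⟨ sumℚ-* (λ i → itemLevel I i (f i) ℓ) (fromℕ D) ⟨
      sumℚ (λ i → itemLevel I i (f i) ℓ ℚ.* fromℕ D)       ≤⟨ sumℚ-mono (λ i → digit-upper i (f i) ℓ (φ≡f i)) ⟩
      sumℚ (λ i → fromℕ (suc (d i)) ℚ.* fromℕ S)           ≡⟨ sumℚ-* (λ i → fromℕ (suc (d i))) (fromℕ S) ⟩
      sumℚ (λ i → fromℕ (suc (d i))) ℚ.* fromℕ S           ≡⟨ cong (ℚ._* fromℕ S) (fromℕ-sumTo (λ i → suc (digit i (φ i) (toℕ ℓ))) n) ⟨
      fromℕ (sumTo (λ i → suc (digit i (φ i) (toℕ ℓ))) n) ℚ.* fromℕ S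
        ≡⟨ cong (λ a → fromℕ a ℚ.* fromℕ S) (sumTo-suc (λ i → digit i (φ i) (toℕ ℓ)) n) ⟩
      fromℕ (roundedLevel φ (toℕ ℓ) + n) ℚ.* fromℕ S       ∎
      where
      open ℚ.≤-Reasoning
      d : Fin n → ℕ
      d i = digit (toℕ i) (φ (toℕ i)) (toℕ ℓ)

  level-≤-peak : ∀ x ℓ → level I x ℓ ℚ.≤ peak I x
  level-≤-peak x = tabulate⁻ (xs≤max 0ℚ (List.tabulate (level I x)))

  rem-cycle : ∀ i ℓ → rem ℓ (padded cycle (toℕ i)) ≡ ℓ % cycle i
  rem-cycle i ℓ = trans (cong (rem ℓ) (padded-cycle i)) (rem≡% ℓ (cycle i))

  ordered-% : ∀ φ i ℓ → let a = ℓ % cycle i; b = φ (toℕ i) % cycle i in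
              ordered φ (toℕ i) ℓ ≡ 1 ∸ distance a b
  ordered-% φ i ℓ = cong₂ (λ a b → 1 ∸ distance a b) (rem-cycle i ℓ) (rem-cycle i (φ (toℕ i)))

  ordered-≡ : ∀ φ i {ℓ} → ℓ % cycle i ≡ φ (toℕ i) % cycle i → ordered φ (toℕ i) ℓ ≡ 1
  ordered-≡ φ i {ℓ} eq = trans (ordered-% φ i ℓ) (cong (1 ∸_) (cong₂ _+_
    (m≤n⇒m∸n≡0 (≤-reflexive eq)) (m≤n⇒m∸n≡0 (≤-reflexive (sym eq)))))

  ordered-≢ : ∀ φ i {ℓ} → ℓ % cycle i ≢ φ (toℕ i) % cycle i → ordered φ (toℕ i) ℓ ≡ 0
  ordered-≢ φ i {ℓ} ne = trans (ordered-% φ i ℓ)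
    (m≤n⇒m∸n≡0 (positive (ℓ % cycle i) (φ (toℕ i) % cycle i) ne))
    where
    positive : ∀ a b → a ≢ b → 1 ≤ distance a b
    positive a b a≢b with <-cmp a b
    ... | tri< a<b _ _ = ≤-trans (m<n⇒0<n∸m a<b) (m≤n+m _ (a ∸ b))
    ... | tri≈ _ a≡b _ = contradiction a≡b a≢b
    ... | tri> _ _ b<a = ≤-trans (m<n⇒0<n∸m b<a) (m≤m+n _ (b ∸ a))

  matrix : (ℕ → ℕ) → Matrix k n
  matrix φ = Vec.tabulate λ i → Vec.tabulate λ j →
    fromℕ< {ordered φ (toℕ i) (toℕ j)} (s≤s (m∸n≤m 1
      (distance (rem (toℕ j) (padded cycle (toℕ i))) (rem (φ (toℕ i)) (padded cycle (toℕ i))))))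

  entry-matrix : ∀ φ i j → entry (matrix φ) i j ≡ ordered φ (toℕ i) (toℕ j)
  entry-matrix φ i j = trans (cong toℕ (trans
    (cong (λ r → lookup r j) (lookup∘tabulate _ i)) (lookup∘tabulate _ j))) (Fin.toℕ-fromℕ< _)

  module _ (φ : ℕ → ℕ) where

    offset : ∀ i → Fin (cycle i)
    offset i = fromℕ< (m%n<n (φ (toℕ i)) (cycle i))

    offset-≡ : ∀ i → φ (toℕ i) % cycle i ≡ toℕ (offset i)
    offset-≡ i = sym (Fin.toℕ-fromℕ< _)

    matrix-once : ∀ i → Once (firstCycle I (matrix φ) i) (offset i)
    matrix-once i =
      trans (first (offset i)) (ordered-≡ φ i (trans (small (offset i)) (sym (offset-≡ i)))) ,
      λ j j≢ → trans (first j) (ordered-≢ φ i λ eq →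
        j≢ (Fin.toℕ-injective (trans (sym (small j)) (trans eq (offset-≡ i)))))
      where
      first : ∀ j → firstCycle I (matrix φ) i j ≡ ordered φ (toℕ i) (toℕ j)
      first j = trans (entry-matrix φ i _) (cong (ordered φ (toℕ i)) (Fin.toℕ-inject≤ j (cycle≤k I i)))
      small : ∀ (j : Fin (cycle i)) → toℕ j % cycle i ≡ toℕ j
      small j = m<n⇒m%n≡m (Fin.toℕ<n j)

    matrix-valid : Valid I (matrix φ)
    matrix-valid = (λ i → once⇒sum _ (offset i) (matrix-once i)) , λ i j j′ eq →
      trans (entry-matrix φ i j) (trans (periodic i j j′ eq) (sym (entry-matrix φ i j′)))
      where
      periodic : ∀ i (j j′ : Fin k) → toℕ j ≡ toℕ j′ + cycle i →
                 ordered φ (toℕ i) (toℕ j) ≡ ordered φ (toℕ i) (toℕ j′)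
      periodic i j j′ eq = cong (λ a → 1 ∸ distance a b)
        (trans (rem-cycle i (toℕ j)) (trans (cong (_% cycle i) eq)
          (trans ([m+n]%n≡m%n (toℕ j′) (cycle i)) (sym (rem-cycle i (toℕ j′))))))
        where b = rem (φ (toℕ i)) (padded cycle (toℕ i))

    matrix-outputs : ∀ σ → (∀ q → q < n * k → arr σ 2 q ≡ outputAt φ q) → Outputs σ (matrix φ)
    matrix-outputs σ written i j = begin
      arr σ 2 (toℕ i * k + toℕ j)          ≡⟨ written _ in-range ⟩
      outputAt φ (toℕ i * k + toℕ j)       ≡⟨ cong₂ (ordered φ) (div-*+ (toℕ i) k _ (Fin.toℕ<n j)) (rem-*+ (toℕ i) k _ (Fin.toℕ<n j)) ⟩
      ordered φ (toℕ i) (toℕ j)            ≡⟨ entry-matrix φ i j ⟨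
      entry (matrix φ) i j                 ∎
      where
      open ≡-Reasoning
      in-range : toℕ i * k + toℕ j < n * k
      in-range = <-≤-trans (+-monoʳ-< (toℕ i * k) (Fin.toℕ<n j))
        (≤-trans (≤-reflexive (+-comm (toℕ i * k) k)) (*-monoˡ-≤ k (Fin.toℕ<n i)))

    open Offsets (matrix φ) φ offset offset-≡ matrix-once

    -- Only the output pays for rounding: its levels exceed the rounded ones by at most n units,
    -- whereas for the optimum rounding down is already the right direction.
    peak-≤ : ∀ ε → 0ℚ ℚ.≤ ε → 1ℚ ℚ.≤ fromℕ m ℚ.* ε → Traced φ →
             peak I (matrix φ) ℚ.≤ (1ℚ ℚ.+ ε) ℚ.* V* I
    -- The 0 included in the maximum of `peak` needs a bound too, hence `0≤V`.
    peak-≤ ε 0≤ε 1≤mε traced = max≤v⁺ (0≤* (ℚ.+-mono-≤ (0≤fromℕ 1) 0≤ε) 0≤V) (tabulate⁺ λ ℓ → ℚ.*-cancelʳ-≤-pos (fromℕ D) ⦃ fromℕ-positive 0<D ⦄ (begin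
      level I (matrix φ) ℓ ℚ.* fromℕ D                    ≤⟨ rounded-upper ℓ ⟩
      fromℕ (roundedLevel φ (toℕ ℓ) + n) ℚ.* fromℕ S      ≤⟨ *-mono-fromℕ S (fromℕ-mono (+-monoˡ-≤ n (best (Fin.toℕ<n ℓ)))) ⟩
      fromℕ (roundedLevel ψ ℓ′ + n) ℚ.* fromℕ S           ≡⟨ trans (cong (ℚ._* fromℕ S) (fromℕ-+ (roundedLevel ψ ℓ′) n)) (ℚ.*-distribʳ-+ (fromℕ S) (fromℕ (roundedLevel ψ ℓ′)) (fromℕ n)) ⟩
      fromℕ (roundedLevel ψ ℓ′) ℚ.* fromℕ S ℚ.+ fromℕ n ℚ.* fromℕ S
                                                          ≤⟨ ℚ.+-mono-≤ peakψ error ⟩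
      V ℚ.* fromℕ D ℚ.+ ε ℚ.* V ℚ.* fromℕ D               ≡⟨ solve 3 (λ V D ε → V :* D :+ ε :* V :* D := (con 1ℚ :+ ε) :* V :* D) refl V (fromℕ D) ε ⟩
      (1ℚ ℚ.+ ε) ℚ.* V ℚ.* fromℕ D                        ∎))
      where
      open ℚ.≤-Reasoning
      open ℚ-Solver
      V = V* I
      0<D : 0 < D
      0<D = *-mono-≤ (*-mono-≤ 0<k 0<m) 0<n
      f : ∀ i → Fin (cycle i)
      f i = proj₁ (sum⇒once _ (proj₁ (optimal-valid I) i))
      ψ : ℕ → ℕ
      ψ = padded λ i → toℕ (f i)
      ψ≡f : ∀ i → ψ (toℕ i) % cycle i ≡ toℕ (f i)
      ψ≡f i = trans (cong (_% cycle i) (padded-toℕ (λ i → toℕ (f i)) i)) (m<n⇒m%n≡m (Fin.toℕ<n (f i)))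
      module Opt = Offsets (optimal I) ψ f ψ≡f (λ i → proj₂ (sum⇒once _ (proj₁ (optimal-valid I) i)))
      -- An order time in the first cycle is below `cycle i ≤ k`, so ψ is among the assignments that
      -- the table minimises over.
      choice′ = traced-optimal traced ψ (padded-< _ 0<k λ i → <-≤-trans (Fin.toℕ<n (f i)) (cycle≤k I i))
      ℓ′ = proj₁ choice′
      ℓ′<k = proj₁ (proj₂ choice′)
      best : ∀ {ℓ} → ℓ < k → roundedLevel φ ℓ ≤ roundedLevel ψ ℓ′
      best = proj₂ (proj₂ choice′)
      level≤V : ∀ ℓ → level I (optimal I) ℓ ℚ.≤ V
      level≤V = level-≤-peak (optimal I)
      peakψ : fromℕ (roundedLevel ψ ℓ′) ℚ.* fromℕ S ℚ.≤ V ℚ.* fromℕ D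
      peakψ = ℚ.≤-trans
        (subst (λ ℓ → fromℕ (roundedLevel ψ ℓ) ℚ.* fromℕ S ℚ.≤ level I (optimal I) (fromℕ< ℓ′<k) ℚ.* fromℕ D)
          (Fin.toℕ-fromℕ< ℓ′<k) (Opt.rounded-lower (fromℕ< ℓ′<k)))
        (*-mono-fromℕ D (level≤V (fromℕ< ℓ′<k)))
      0≤V : 0ℚ ℚ.≤ V
      0≤V = ⊥≤max 0ℚ (List.tabulate (level I (optimal I)))
      error : fromℕ n ℚ.* fromℕ S ℚ.≤ ε ℚ.* V ℚ.* fromℕ D
      error = begin
        fromℕ n ℚ.* fromℕ S                              ≤⟨ ℚ.*-monoˡ-≤-nonNeg (fromℕ n) ⦃ ℚ.normalize-nonNeg n 1 ⦄ (ℚ.≤-trans (Opt.size-≤ (fromℕ< 0<k)) (*-mono-fromℕ k (level≤V _))) ⟩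
        fromℕ n ℚ.* (V ℚ.* fromℕ k)                      ≡⟨ ℚ.*-identityʳ _ ⟨
        fromℕ n ℚ.* (V ℚ.* fromℕ k) ℚ.* 1ℚ               ≤⟨ ℚ.*-monoˡ-≤-nonNeg (fromℕ n ℚ.* (V ℚ.* fromℕ k)) ⦃ ℚ.nonNegative (0≤* (0≤fromℕ n) (0≤* 0≤V (0≤fromℕ k))) ⦄ 1≤mε ⟩
        fromℕ n ℚ.* (V ℚ.* fromℕ k) ℚ.* (fromℕ m ℚ.* ε)  ≡⟨ solve 5 (λ n V k m ε → n :* (V :* k) :* (m :* ε) := ε :* V :* (k :* m :* n)) refl (fromℕ n) V (fromℕ k) (fromℕ m) ε ⟩
        ε ℚ.* V ℚ.* (fromℕ k ℚ.* fromℕ m ℚ.* fromℕ n)    ≡⟨ cong (ε ℚ.* V ℚ.*_) (trans (cong (ℚ._* fromℕ n) (sym (fromℕ-* k m))) (sym (fromℕ-* (k * m) n))) ⟩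
        ε ℚ.* V ℚ.* fromℕ D                              ∎

  halts-approximates : ∀ {P σ T} ε → 0ℚ ℚ.≤ ε → 1ℚ ℚ.≤ fromℕ m ℚ.* ε →
    Halts P σ (Optimal refl refl fits 0<n) T →
    ∃[ τ ] ∃[ t ] Run P σ τ t ×
      ∃[ x ] Outputs τ x × Valid I x × peak I x ℚ.≤ (1ℚ ℚ.+ ε) ℚ.* V* I
  halts-approximates ε 0≤ε 1≤mε (τ , t , run , _ , φ , traced , written) =
    τ , t , run , matrix φ , matrix-outputs φ τ written , matrix-valid φ ,
    peak-≤ φ ε 0≤ε 1≤mε traced

-- Running time in n and 1/ε.

^-distribʳ-* : ∀ l x y → (x * y) ^ l ≡ x ^ l * y ^ l
^-distribʳ-* zero    x y = refl
^-distribʳ-* (suc l) x y =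
  trans (cong (x * y *_) (^-distribʳ-* l x y)) ([m*n]*[o*p]≡[m*o]*[n*p] x y (x ^ l) (y ^ l))

-- As `1 ≤ m * n`, the base is at most `suc k * (m * n)`; the factor `suc k ^ k` is constant.
n*[1+kmn]^k≤ : ∀ k {m n} → 0 < m → 0 < n →
          n * suc (k * m * n) ^ k ≤ suc k ^ k * (n ^ suc k * m ^ k)
n*[1+kmn]^k≤ k {m} {n} 0<m 0<n = begin
  n * suc (k * m * n) ^ k            ≤⟨ *-monoʳ-≤ n (^-monoˡ-≤ k (+-mono-≤ (*-mono-≤ 0<m 0<n) (≤-reflexive (*-assoc k m n)))) ⟩
  n * (suc k * (m * n)) ^ k          ≡⟨ cong (n *_) (trans (^-distribʳ-* k (suc k) (m * n)) (cong (suc k ^ k *_) (^-distribʳ-* k m n))) ⟩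
  n * (suc k ^ k * (m ^ k * n ^ k))  ≡⟨ solve 4 (λ n a b c → n :* (a :* (b :* c)) := a :* ((n :* c) :* b)) refl n (suc k ^ k) (m ^ k) (n ^ k) ⟩
  suc k ^ k * (n ^ suc k * m ^ k)    ∎
  where
  open ≤-Reasoning
  open +-*-Solver

*-mono-0≤ : ∀ {x y u v} → 0ℚ ℚ.≤ x → x ℚ.≤ y → 0ℚ ℚ.≤ u → u ℚ.≤ v → x ℚ.* u ℚ.≤ y ℚ.* v
*-mono-0≤ {x} {y} {u} {v} 0≤x x≤y 0≤u u≤v = ℚ.≤-trans
  (ℚ.*-monoʳ-≤-nonNeg u ⦃ ℚ.nonNegative 0≤u ⦄ x≤y)
  (ℚ.*-monoˡ-≤-nonNeg y ⦃ ℚ.nonNegative (ℚ.≤-trans 0≤x x≤y) ⦄ u≤v)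

0≤^ : ∀ {x} l → 0ℚ ℚ.≤ x → 0ℚ ℚ.≤ x ^ℚ l
0≤^ zero    0≤x = 0≤fromℕ 1
0≤^ (suc l) 0≤x = 0≤* 0≤x (0≤^ l 0≤x)

^-mono-0≤ : ∀ {x y} l → 0ℚ ℚ.≤ x → x ℚ.≤ y → x ^ℚ l ℚ.≤ y ^ℚ l
^-mono-0≤ zero    0≤x x≤y = ℚ.≤-refl
^-mono-0≤ (suc l) 0≤x x≤y = *-mono-0≤ 0≤x x≤y (0≤^ l 0≤x) (^-mono-0≤ l 0≤x x≤y)

-- ⌊ 1 / ε ⌋ + 1 if ε > 0
precision : ℚ → ℕ
precision ε = suc (⟦ div ⟧ (ℚ.↧ₙ ε) ℤ.∣ ℚ.↥ ε ∣)

*-denominator : ∀ q a → ℚ.↥ q ≡ ℤ.+ a → q ℚ.* fromℕ (ℚ.↧ₙ q) ≡ fromℕ a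
*-denominator q a eq = trans
  (cong (ℚ._* fromℕ (ℚ.↧ₙ q)) (trans (sym (ℚ.↥p/↧p≡p q)) (cong (ℚ._/ ℚ.↧ₙ q) eq)))
  (/-*-fromℕ a (ℚ.↧ₙ q))

module _ (k : ℕ) .⦃ _ : NonZero k ⦄ where

  open Program k

  -- For ε = (p + 1) / (d + 1), rounding the quotient of d + 1 by p + 1 down and adding 1 exceeds
  -- that quotient.
  1≤precision*ε : ∀ ε .⦃ _ : Positive ε ⦄ → 1ℚ ℚ.≤ fromℕ (precision ε) ℚ.* ε
  1≤precision*ε ε@(ℚ.mkℚ (ℤ.+[1+ p ]) d coprime) = ≤-from-multiples (suc d) (s≤s z≤n)
    (ℚ.*-identityˡ (fromℕ (suc d)))
    (trans (ℚ.*-assoc (fromℕ m) ε (fromℕ (suc d)))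
      (trans (cong (fromℕ m ℚ.*_) (*-denominator ε (suc p) refl)) (sym (fromℕ-* m (suc p)))))
    (<⇒≤ (<div* (suc d) (suc p) (s≤s z≤n)))
    where m = precision ε

  precision-≤ : ∀ ε .⦃ _ : Positive ε ⦄ → fromℕ (precision ε) ℚ.≤ 1ℚ ℚ.+ recip k ε
  precision-≤ ε@(ℚ.mkℚ (ℤ.+[1+ p ]) d coprime) = ≤-from-multiples (suc p) (s≤s z≤n)
    (sym (fromℕ-* (precision ε) (suc p)))
    (trans (ℚ.*-distribʳ-+ (fromℕ (suc p)) 1ℚ (recip k ε))
      (trans (cong₂ ℚ._+_ (ℚ.*-identityˡ (fromℕ (suc p))) (*-denominator (recip k ε) (suc d) refl))
        (sym (fromℕ-+ (suc p) (suc d)))))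
    (+-monoʳ-≤ (suc p) (div*≤ (suc d) (suc p)))

  0≤recip : ∀ ε .⦃ _ : Positive ε ⦄ → 0ℚ ℚ.≤ recip k ε
  0≤recip ε = ℚ.<⇒≤ (ℚ.positive⁻¹ (recip k ε) ⦃ ℚ.1/pos⇒pos ε ⦄)

  1≤recip : ∀ ε .⦃ _ : Positive ε ⦄ → ε ℚ.≤ 1ℚ → 1ℚ ℚ.≤ recip k ε
  1≤recip ε ε≤1 = begin
    1ℚ                ≡⟨ ℚ.*-inverseˡ ε ⦃ ℚ.pos⇒nonZero ε ⦄ ⟨
    recip k ε ℚ.* ε   ≤⟨ ℚ.*-monoˡ-≤-nonNeg (recip k ε) ⦃ ℚ.nonNegative (0≤recip ε) ⦄ ε≤1 ⟩
    recip k ε ℚ.* 1ℚ  ≡⟨ ℚ.*-identityʳ (recip k ε) ⟩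
    recip k ε         ∎
    where open ℚ.≤-Reasoning

  scheme : ℚ → Cmd
  scheme ε = program (precision ε)

  stepsFactor : ℕ
  stepsFactor = sum factors * suc k ^ k

  module _ (ε : ℚ) (n : ℕ) .⦃ _ : NonZero n ⦄ (I : Instance k n) where
    private
      module A = Analysis (>-nonZero⁻¹ n) I (precision ε) (s≤s z≤n)
      module R = Rounding k A.0<k A.env A.cyc>0 refl A.0<S refl
      module C = Correctness k A.0<k A.env R.0<M

    scheme-halts : Halts (scheme ε) (input I) (C.Optimal refl refl R.fits (>-nonZero⁻¹ n))
                         (sum factors * (n * Env.M A.env))
    scheme-halts = C.program-halts refl refl R.fits (>-nonZero⁻¹ n) (precision ε) refl
      -- Registers 1 and 4 start at 0: nothing is summed and n iterations remain.
      (refl , refl , refl , refl , refl)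

    scheme-approximates : .⦃ _ : Positive ε ⦄ →
      ∃[ τ ] ∃[ t ] Run (scheme ε) (input I) τ t ×
        ∃[ x ] Outputs τ x × Valid I x × peak I x ℚ.≤ (1ℚ ℚ.+ ε) ℚ.* V* I
    scheme-approximates = A.halts-approximates {P = scheme ε} {σ = input I}
      ε (ℚ.<⇒≤ (ℚ.positive⁻¹ ε)) (1≤precision*ε ε) scheme-halts

    steps-≤ : ∀ {τ t} → Run (scheme ε) (input I) τ t →
              t ≤ stepsFactor * (n ^ suc k * precision ε ^ k)
    steps-≤ {t = t} run = begin
      t                                          ≤⟨ halts⇒≤ scheme-halts run ⟩
      sum factors * (n * Env.M A.env)            ≤⟨ *-monoʳ-≤ (sum factors) (n*[1+kmn]^k≤ k (s≤s z≤n) (>-nonZero⁻¹ n)) ⟩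
      sum factors * (suc k ^ k * (n ^ suc k * precision ε ^ k))  ≡⟨ *-assoc (sum factors) (suc k ^ k) _ ⟨
      stepsFactor * (n ^ suc k * precision ε ^ k)  ∎
      where open ≤-Reasoning

  module _ (ε : ℚ) .⦃ _ : Positive ε ⦄ where
    private
      r = recip k ε
      m = precision ε

    stepsℚ-≤ : ∀ {n} .⦃ _ : NonZero n ⦄ {I : Instance k n} {τ t} → Run (scheme ε) (input I) τ t →
      fromℕ t ℚ.≤ fromℕ stepsFactor ℚ.* (fromℕ n ^ℚ suc k ℚ.* fromℕ m ^ℚ k)
    stepsℚ-≤ {n} {I} run = ℚ.≤-trans (fromℕ-mono (steps-≤ ε n I run)) (ℚ.≤-reflexive
      (trans (fromℕ-* stepsFactor (n ^ suc k * m ^ k)) (cong (fromℕ stepsFactor ℚ.*_)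
        (trans (fromℕ-* (n ^ suc k) (m ^ k)) (cong₂ ℚ._*_ (fromℕ-^ n (suc k)) (fromℕ-^ m k))))))

    -- Since `1 ≤ n`, both n and `m ≤ 1 + 1/ε` are at most n + 1/ε, without an upper bound on ε. The
    -- exponents k + 1 and k add up.
    scheme-polynomial : RunsWithin k
      (λ n → fromℕ stepsFactor ℚ.* (fromℕ n ℚ.+ r) ^ℚ (suc k + k)) (scheme ε)
    scheme-polynomial n I {t = t} run = begin
      fromℕ t                                                            ≤⟨ stepsℚ-≤ run ⟩
      fromℕ stepsFactor ℚ.* (fromℕ n ^ℚ suc k ℚ.* fromℕ m ^ℚ k)          ≤⟨ *-mono-0≤ (0≤fromℕ stepsFactor) ℚ.≤-refl
        (0≤* (0≤^ (suc k) (0≤fromℕ n)) (0≤^ k (0≤fromℕ m)))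
        (*-mono-0≤ (0≤^ (suc k) (0≤fromℕ n)) (^-mono-0≤ (suc k) (0≤fromℕ n) n≤N)
          (0≤^ k (0≤fromℕ m)) (^-mono-0≤ k (0≤fromℕ m) m≤N)) ⟩
      fromℕ stepsFactor ℚ.* (N ^ℚ suc k ℚ.* N ^ℚ k)                      ≡⟨ cong (fromℕ stepsFactor ℚ.*_) (ℚ-Exp.^-homo-* N (suc k) k) ⟨
      fromℕ stepsFactor ℚ.* N ^ℚ (suc k + k)                             ∎
      where
      open ℚ.≤-Reasoning
      N = fromℕ n ℚ.+ r
      n≤N : fromℕ n ℚ.≤ N
      n≤N = subst (ℚ._≤ N) (ℚ.+-identityʳ (fromℕ n)) (ℚ.+-monoʳ-≤ (fromℕ n) (0≤recip ε))
      m≤N : fromℕ m ℚ.≤ N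
      m≤N = ℚ.≤-trans (precision-≤ ε) (ℚ.+-monoˡ-≤ r (fromℕ-mono {1} {n} (>-nonZero⁻¹ n)))

    -- For `ε ≤ 1`, m is at most 1 + 1/ε ≤ 2/ε, which yields the factor `2 ^ k`. For fixed n and
    -- large ε the bound would drop below a single step.
    scheme-runsWithin : ε ℚ.≤ 1ℚ → RunsWithin k
      (λ n → fromℕ (stepsFactor * 2 ^ k) ℚ.* fromℕ n ^ℚ suc k ℚ.* r ^ℚ k) (scheme ε)
    scheme-runsWithin ε≤1 n I {t = t} run = begin
      fromℕ t                                                            ≤⟨ stepsℚ-≤ run ⟩
      fromℕ stepsFactor ℚ.* (p ℚ.* fromℕ m ^ℚ k)                         ≤⟨ *-mono-0≤ (0≤fromℕ stepsFactor) ℚ.≤-refl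
        (0≤* 0≤p (0≤^ k (0≤fromℕ m))) (*-mono-0≤ 0≤p ℚ.≤-refl (0≤^ k (0≤fromℕ m)) (^-mono-0≤ k (0≤fromℕ m) m≤2r)) ⟩
      fromℕ stepsFactor ℚ.* (p ℚ.* (fromℕ 2 ℚ.* r) ^ℚ k)                 ≡⟨ cong (λ q → fromℕ stepsFactor ℚ.* (p ℚ.* q))
        (trans (ℚ-CommutativeExp.^-distrib-* (fromℕ 2) r k) (cong (ℚ._* r ^ℚ k) (sym (fromℕ-^ 2 k)))) ⟩
      fromℕ stepsFactor ℚ.* (p ℚ.* (fromℕ (2 ^ k) ℚ.* r ^ℚ k))           ≡⟨ solve 4 (λ a p b q → a :* (p :* (b :* q)) := a :* b :* p :* q) refl (fromℕ stepsFactor) p (fromℕ (2 ^ k)) (r ^ℚ k) ⟩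
      fromℕ stepsFactor ℚ.* fromℕ (2 ^ k) ℚ.* p ℚ.* r ^ℚ k               ≡⟨ cong (λ a → a ℚ.* p ℚ.* r ^ℚ k) (fromℕ-* stepsFactor (2 ^ k)) ⟨
      fromℕ (stepsFactor * 2 ^ k) ℚ.* p ℚ.* r ^ℚ k                       ∎
      where
      open ℚ.≤-Reasoning
      open ℚ-Solver
      p = fromℕ n ^ℚ suc k
      0≤p : 0ℚ ℚ.≤ p
      0≤p = 0≤^ (suc k) (0≤fromℕ n)
      m≤2r : fromℕ m ℚ.≤ fromℕ 2 ℚ.* r
      m≤2r = ℚ.≤-trans (precision-≤ ε) (ℚ.≤-trans (ℚ.+-monoˡ-≤ r (1≤recip ε ε≤1))
        (ℚ.≤-reflexive (solve 1 (λ r → r :+ r := (con 1ℚ :+ con 1ℚ) :* r) refl r)))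

mainTheorem1 : (k : ℕ) .⦃ _ : NonZero k ⦄ →
  Σ[ S ∈ FPTAS k ] ∃[ C ]
    ((ε : ℚ) .⦃ _ : Positive ε ⦄ → ε ℚ.≤ 1ℚ →
      RunsWithin k (λ n → fromℕ C ℚ.* fromℕ n ^ℚ suc k ℚ.* recip k ε ^ℚ k)
        (FPTAS.algorithm S ε))
mainTheorem1 k =
  record { algorithm     = scheme k
         ; approximation = λ ε n I → scheme-approximates k ε n I
         ; polynomial    = stepsFactor k , suc k + k , λ ε → scheme-polynomial k ε } ,
  stepsFactor k * 2 ^ k , λ ε → scheme-runsWithin k ε
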